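{- Fix integers $k\ge 3$ and $1\le i\le k-1$, and let $m$ be a positive integer and $n\ge 0$ an integer. (1) The number of $(k,i)$-singular overpartitions of $n$ with exactly $m$ dotted blocks and whose last dotted block is negative equals $p\left(n-k\binom{m}{2}-im\right)$. (2) The number of $(k,i)$-singular overpartitions of $n$ with exactly $m$ dotted blocks and whose last dotted block is positive equals $p\left(n-k\binom{m+1}{2}+im\right)$.
   Context: $p(N)$ denotes the number of ordinary partitions of $N$, with $p(0)=1$ and $p(N)=0$ for $N<0$. A Frobenius symbol for $n$ is a two-rowed array $\begin{pmatrix} a_1 & \cdots & a_\delta\\ b_1&\cdots&b_\delta\end{pmatrix}$ ($\delta\ge0$) of integers with $a_1>\cdots>a_\delta\ge 0$, $b_1>\cdots>b_\delta\ge0$ and $\sum_{t=1}^\delta(a_t+b_t+1)=n$. A column $(a_t;b_t)$ is $(k,i)$-positive if $a_t-b_t\ge k-i-1$, $(k,i)$-negative if $a_t-b_t\le 1-i$, and $(k,i)$-neutral otherwise. The columns are divided into $(k,i)$-parity blocks: sets of contiguous columns, maximally extended to the right, in which all non-neutral columns have the same parity. Concretely, the first block starts at the first column, and a new block starts at each non-neutral column whose parity is opposite to that of the nearest non-neutral column to its left. A block is called positive (resp. negative) if its non-neutral columns are positive (resp. negative). If all columns are neutral, there is a single neutral block. The anchor of a non-neutral block is its first non-neutral column. Number the non-neutral blocks $B_1,B_2,\dots$ from left to right; their parities alternate. A $(k,i)$-singular overpartition of $n$ is a Frobenius symbol for $n$ in which some entries may be overlined, subject to exactly one of the following: (a) there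 are no overlined entries; (b) there is exactly one overlined entry, it lies in the top row, and it is in the anchor of a positive block; (c) there is exactly one overlined entry, it lies in the bottom row, and it is in the anchor of a negative block; (d) there are exactly two overlined entries, lying in the anchors of two consecutive non-neutral blocks: one in the top row of the anchor of the positive block and the other in the bottom row of the anchor of the negative block. Dotted blocks are determined as follows. In case (a) no block is dotted. In cases (b) and (c), if the overlined entry lies in $B_j$, the dotted blocks are $B_1,\dots,B_j$. In case (d), if the overlined entries lie in $B_j$ and $B_{j+1}$, the dotted blocks are $B_2,\dots,B_{j+1}$. The last dotted block is the rightmost dotted block. -}

module Defs where

open import Data.Nat using (ℕ; zero; suc; _+_; _*_; _≤_; _<_; _≥_)
open import Data.Nat.Combinatorics using (_C_)
open import Data.Integer as ℤ using (ℤ; +_; -[1+_])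
open import Data.Bool using (Bool; true; false; if_then_else_)
open import Data.List using (List; []; _∷_; _++_; map; lookup; length)
open import Data.Nat.ListAction using (sum)
open import Data.List.Relation.Unary.All using (All)
open import Data.List.Relation.Unary.Linked using (Linked)
open import Data.Maybe using (Maybe; just; nothing)
open import Data.Product using (Σ; _×_; _,_)
open import Data.Empty using (⊥)
open import Data.Fin using (Fin; toℕ)
open import Relation.Nullary using (yes; no)
open import Relation.Binary.PropositionalEquality using (_≡_)

Partition : ℕ → Set
Partition N = Σ (List ℕ) λ xs → All (λ x → 1 ≤ x) xs × Linked _≥_ xs × sum xs ≡ N

PartitionZ : ℤ → Set
PartitionZ (+ N)      = Partition N
PartitionZ -[1+ _ ]   = ⊥

-- A column (a_t ; b_t) together with flags saying whether the top entry a_t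
-- and/or the bottom entry b_t is overlined.
record Column : Set where
  constructor col
  field
    top    : ℕ
    bot    : ℕ
    ovTop  : Bool
    ovBot  : Bool
open Column public

IsFrobenius : ℕ → List Column → Set
IsFrobenius n cs =
  Linked _>_ (map top cs) × Linked _>_ (map bot cs)
  × sum (map (λ c → top c + bot c + 1) cs) ≡ n
  where open Data.Nat using (_>_)

data Sign : Set where
  positive negative : Sign

-- (k,i)-kind of a column: just positive / just negative / nothing (= neutral).
kind : ℕ → ℕ → Column → Maybe Sign
kind k i c with (+ k ℤ.- + i ℤ.- + 1) ℤ.≤? (+ top c ℤ.- + bot c)
... | yes _ = just positive
... | no _ with (+ top c ℤ.- + bot c) ℤ.≤? (+ 1 ℤ.- + i)
...   | yes _ = just negative
...   | no _  = nothing

sameSign : Sign → Sign → Bool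
sameSign positive positive = true
sameSign negative negative = true
sameSign _ _ = false

-- Anchors of the non-neutral (k,i)-parity blocks, in order B_1, B_2, ...:
-- each entry is (column position (0-based), sign of the block).
-- A non-neutral column is an anchor iff there is no non-neutral column to
-- its left or the nearest one has the opposite parity.
anchorsFrom : ℕ → Maybe Sign → List (Maybe Sign) → List (ℕ × Sign)
anchorsFrom p last [] = []
anchorsFrom p last (nothing ∷ ks) = anchorsFrom (suc p) last ks
anchorsFrom p nothing (just s ∷ ks) = (p , s) ∷ anchorsFrom (suc p) (just s) ks
anchorsFrom p (just t) (just s ∷ ks) =
  if sameSign s t then anchorsFrom (suc p) (just t) ks
                  else (p , s) ∷ anchorsFrom (suc p) (just s) ks

anchors : ℕ → ℕ → List Column → List (ℕ × Sign)
anchors k i cs = anchorsFrom 0 nothing (map (kind k i) cs)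

data Row : Set where
  topRow botRow : Row

-- the row carrying the overline in the anchor of a block of a given sign
rowOf : Sign → Row
rowOf positive = topRow
rowOf negative = botRow

overlinedFrom : ℕ → List Column → List (ℕ × Row)
overlinedFrom p [] = []
overlinedFrom p (c ∷ cs) =
  (if ovTop c then (p , topRow) ∷ [] else []) ++
  (if ovBot c then (p , botRow) ∷ [] else []) ++ overlinedFrom (suc p) cs

overlined : List Column → List (ℕ × Row)
overlined = overlinedFrom 0

-- SingularCase k i cs m s : the overlining of cs is as in one of cases
-- (a)-(d), and the number of dotted blocks is m, with the last dotted block
-- having sign s (nothing when there are no dotted blocks).
-- Block B_{j+1} (1-based) has anchor  lookup (anchors k i cs) j  (0-based j).
data SingularCase (k i : ℕ) (cs : List Column) : ℕ → Maybe Sign → Set where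
  caseA : overlined cs ≡ [] → SingularCase k i cs 0 nothing
  -- (b) one overline, top row, anchor of positive block B_{j+1}:
  --     dotted blocks B_1..B_{j+1}
  caseB : ∀ (j : Fin (length (anchors k i cs))) c →
          lookup (anchors k i cs) j ≡ (c , positive) →
          overlined cs ≡ (c , topRow) ∷ [] →
          SingularCase k i cs (suc (toℕ j)) (just positive)
  -- (c) one overline, bottom row, anchor of negative block B_{j+1}:
  --     dotted blocks B_1..B_{j+1}
  caseC : ∀ (j : Fin (length (anchors k i cs))) c →
          lookup (anchors k i cs) j ≡ (c , negative) →
          overlined cs ≡ (c , botRow) ∷ [] →
          SingularCase k i cs (suc (toℕ j)) (just negative)
  -- (d) two overlines, in the anchors of B_{j} and B_{j+1} (1-based; here
  --     j is 0-based so blocks B_{j+1}, B_{j+2}), top row for the positive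
  --     one and bottom row for the negative one: dotted blocks B_2..B_{j+2},
  --     i.e. j+1 of them, the last being B_{j+2}.
  caseD : ∀ (j j' : Fin (length (anchors k i cs))) → toℕ j' ≡ suc (toℕ j) →
          ∀ c₁ s₁ c₂ s₂ →
          lookup (anchors k i cs) j ≡ (c₁ , s₁) →
          lookup (anchors k i cs) j' ≡ (c₂ , s₂) →
          overlined cs ≡ (c₁ , rowOf s₁) ∷ (c₂ , rowOf s₂) ∷ [] →
          SingularCase k i cs (suc (toℕ j)) (just s₂)

SingOverpartition : (k i n m : ℕ) → Sign → Set
SingOverpartition k i n m s =
  Σ (List Column) λ cs → IsFrobenius n cs × SingularCase k i cs m (just s)

{-# OPTIONS --safe #-}

-- Since block signs alternate, a symbol carries a (unique) overlining with m dotted blocks,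
-- the last of sign s, iff its columns contain m alternating non-neutral columns ending in
-- sign s: overline one anchor if the block count fits, two if the first block must be skipped.
-- Choose these columns greedily from the left.  Exchanging the tails of the two rows at each
-- chosen column (André reflection, with a translation that keeps the rows strictly
-- decreasing and nonnegative) turns the symbol into a pair of strictly decreasing rows whose
-- lengths differ by 2m, and every such pair arises exactly once.  Such pairs are partitions
-- again, read through hooks relative to a rectangle of charge 2m, and each exchange lowers the
-- size by an amount that is linear in its index; summing gives k(m choose 2) + im, or the same
-- with k - i in place of i.
module Submission where

-- The amount of the translation is forced. Call a chosen column a hit and let `p` be the threshold
-- of its sign. Both entries of a hit go into the longer output row, `b` before `a`, and these
-- outputs should decrease exactly when `a + p ≤ b`. So the translation must change by `p - 1` at
-- the hit; as nothing is translated after the last hit, it equals the sum of the thresholds still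
-- to come minus their number. This also explains the lengths: every hit gives two entries to one
-- row and none to the other.
--
-- The thresholds `i - 1` and `k - i - 1` alternate, so their sum depends on the parity of the
-- number of hits; doubled and completed by one more threshold it becomes linear, and the factor `k`
-- is the sum of both thresholds plus 2.
--
-- The assumption `k ≥ 3` says that the thresholds do not both vanish. Then no column is a hit for
-- both signs, and a hit, read with its rows exchanged, is not a hit for the next sign; this keeps
-- the other output row decreasing across an exchange.

module SingularOverpartitions where

  open import Defs
  open import Data.Nat
  open import Data.Nat.Properties hiding (≡-irrelevant)
  open import Data.Nat.Combinatorics using (_C_; nCk+nC[k+1]≡[n+1]C[k+1]; nC1≡n)
  open import Data.Nat.ListAction using (sum)
  open import Data.Nat.Tactic.RingSolver using (solve)
  open import Data.Integer as ℤ using (-[1+_]) renaming (+_ to pos)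
  import Data.Integer.Properties as ℤ
  import Data.Integer.Tactic.RingSolver as ℤ
  open import Data.Bool using (true; false; if_then_else_)
  open import Data.Fin as Fin using (toℕ)
  open import Data.Fin.Properties using (toℕ-injective)
  open import Data.Maybe using (Maybe; just; nothing)
  open import Data.List using (List; []; _∷_; _++_; map; length; lookup)
  open import Data.List.Properties using (∷-injective; length-map)
  open import Data.List.Relation.Unary.All as All using (All)
  open import Data.List.Relation.Unary.Linked as Linked using (Linked)
  open import Data.Product using (Σ; _×_; _,_; proj₁; proj₂; ∃; ∃₂)
  open import Data.Sum using (_⊎_; inj₁; inj₂)
  open import Data.Empty using (⊥; ⊥-elim)
  open import Function using (_∘_)
  open import Function.Bundles using (_↔_; mk↔ₛ′; _⇔_; mk⇔; Equivalence)
  open import Function.Construct.Composition using (_↔-∘_)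
  open import Relation.Nullary using (yes; no)
  open import Relation.Binary.PropositionalEquality using (_≡_; _≢_; refl; sym; trans; cong; cong₂; subst; subst₂)
  open import Relation.Binary.PropositionalEquality.WithK using (≡-irrelevant)

  -- Linear arithmetic: add up hypotheses to x ≤ y with slack r, and let the ring
  -- solver check that v - u = (y - x) + r, with the subtractions moved across.
  lin : ∀ {x y u v} r → x ≤ y → u + y + r ≡ v + x → u ≤ v
  lin {x} {y} {u} {v} r h e = +-cancelʳ-≤ y u v
    (≤-trans (m≤m+n (u + y) r) (≤-trans (≤-reflexive e) (+-monoʳ-≤ v h)))

  eqn : ∀ {x y u v} → x ≡ y → u + y ≡ v + x → u ≡ v
  eqn {x} {y} {u} {v} refl e = +-cancelʳ-≡ y u v e

  infixr 5 _⊕_ _⊞_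
  _⊕_ : ∀ {a b c d} → a ≤ b → c ≤ d → a + c ≤ b + d
  _⊕_ = +-mono-≤

  _⊞_ : ∀ {a b c d : ℕ} → a ≡ b → c ≡ d → a + c ≡ b + d
  _⊞_ = cong₂ _+_

  subtract : ∀ {a b} → b ≤ a → ∃ λ x → x + b ≡ a
  subtract {a} {b} b≤a = a ∸ b , m∸n+n≡m b≤a

  ≡⇒≥ : ∀ {a b : ℕ} → a ≡ b → b ≤ a
  ≡⇒≥ e = ≤-reflexive (sym e)

  -- The condition on the head is a predicate rather than a bound because translation turns `a < u`
  -- into inequalities such as `x + m < u + altSum m p q`, which are kept free of subtraction.
  data Decreasing (P : ℕ → Set) : List ℕ → Set where
    end : Decreasing P []
    _▸_ : ∀ {a A} → P a → Decreasing (_< a) A → Decreasing P (a ∷ A)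

  infixr 5 _▸_

  mapDec : ∀ {P Q A} → (∀ {x} → P x → Q x) → Decreasing P A → Decreasing Q A
  mapDec f end      = end
  mapDec f (a ▸ As) = f a ▸ As

  length≤ : ∀ {u A} → Decreasing (_< u) A → length A ≤ u
  length≤ end        = z≤n
  length≤ (a<u ▸ As) = ≤-trans (s≤s (length≤ As)) a<u

  -- Exchanging tails

  altSum : ℕ → ℕ → ℕ → ℕ
  altSum zero    p q = 0
  altSum (suc m) p q = p + altSum m q p

  -- With p = i - 1 and q = k - i - 1 a column (a ; b) is negative iff a + p ≤ b and
  -- positive iff b + q ≤ a; exchanging the rows after each hit makes both look alike.
  data Oscillates : ℕ → ℕ → ℕ → List ℕ → List ℕ → Set where
    done : ∀ {p q A B} → Oscillates 0 p q A B
    here : ∀ {m p q a b A B} → a + p ≤ b → Oscillates m q p B A →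
           Oscillates (suc m) p q (a ∷ A) (b ∷ B)
    skip : ∀ {m p q a b A B} → b < a + p → Oscillates (suc m) p q A B →
           Oscillates (suc m) p q (a ∷ A) (b ∷ B)

  -- With m hits still to come, entries are translated by altSum m p q - m in the first row
  -- and by the negative of this in the second; a hit exchanges the remaining tails.  All
  -- equations are written without subtraction.  The bounds u, v play the role of a preceding column,
  -- which is not negative when v < u + p.
  data Reflection : (m p q u v : ℕ) → (A B X Y : List ℕ) → Set where
    done   : ∀ {p q u v A B} → Decreasing (_< u) A → Decreasing (_< v) B →
             Reflection 0 p q u v A B A B
    switch : ∀ {m p q u v a b y₁ y₂ A B X Y} → a < u → b < v → a + p ≤ b →
             y₁ + (p + altSum m q p) ≡ b + suc m → y₂ + altSum m q p ≡ a + m →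
             Reflection m q p b a B A X Y →
             Reflection (suc m) p q u v (a ∷ A) (b ∷ B) X (y₁ ∷ y₂ ∷ Y)
    keep   : ∀ {m p q u v a b x y A B X Y} → a < u → b < v → b < a + p →
             x + suc m ≡ a + (p + altSum m q p) → y + (p + altSum m q p) ≡ b + suc m →
             Reflection (suc m) p q a b A B X Y →
             Reflection (suc m) p q u v (a ∷ A) (b ∷ B) (x ∷ X) (y ∷ Y)

  private
    low-here : ∀ {a b v p m} T → a + p ≤ b → b < v → T + m ≤ a → p + T + suc m ≤ v
    low-here {a} {b} {v} {p} {m} T h₁ h₂ h₃ = lin 0 (h₁ ⊕ h₂ ⊕ h₃) (solve (a ∷ b ∷ v ∷ p ∷ m ∷ T ∷ []))

  -- Each remaining hit costs its threshold, and one more unit for the strict descent of its row;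
  -- the exchanges chain these costs into one inequality. It guarantees that the translated entries
  -- are natural numbers.
  oscillation-bound : ∀ {m p q u v A B} → Oscillates m p q A B →
    Decreasing (_< u) A → Decreasing (_< v) B → altSum m p q + m ≤ v
  oscillation-bound done _ _ = z≤n
  oscillation-bound {suc m} {p} {q} (here h o) (_ ▸ As) (b<v ▸ Bs) =
    low-here (altSum m q p) h b<v (oscillation-bound o Bs As)
  oscillation-bound (skip _ o) (_ ▸ As) (b<v ▸ Bs) =
    ≤-trans (oscillation-bound o As Bs) (<⇒≤ b<v)

  private
    x-exists : ∀ {a b p m} T → b < a + p → p + T + suc m ≤ b → suc m ≤ a + (p + T)
    x-exists {a} {b} {p} {m} T h₁ h₂ = lin (1 + T + p + T) (h₁ ⊕ h₂) (solve (a ∷ b ∷ p ∷ m ∷ T ∷ []))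

    y-exists : ∀ {b m} T → T + m ≤ b → T ≤ b + m
    y-exists {b} {m} T h = lin (m + m) h (solve (b ∷ m ∷ T ∷ []))

    y₁-exists : ∀ {a b p m} T → a + p ≤ b → T + m ≤ a → p + T ≤ b + suc m
    y₁-exists {a} {b} {p} {m} T h₁ h₂ = lin (m + m + 1) (h₁ ⊕ h₂) (solve (a ∷ b ∷ p ∷ m ∷ T ∷ []))

  reflect : ∀ {m p q u v A B} → Oscillates m p q A B →
    Decreasing (_< u) A → Decreasing (_< v) B →
    ∃₂ λ X Y → Reflection m p q u v A B X Y
  reflect done As Bs = _ , _ , done As Bs
  reflect {suc m} {p} {q} (here h o) (a<u ▸ As) (b<v ▸ Bs)
    with reflect o Bs As | oscillation-bound o Bs As
  ... | X , Y , R | low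
    with subtract (y₁-exists (altSum m q p) h low) | subtract (y-exists (altSum m q p) low)
  ... | y₁ , e₁ | y₂ , e₂ = _ , _ , switch {y₁ = y₁} {y₂} a<u b<v h e₁ e₂ R
  reflect {suc m} {p} {q} (skip h o) (a<u ▸ As) (b<v ▸ Bs)
    with reflect o As Bs | oscillation-bound o As Bs
  ... | X , Y , R | low
    with subtract (x-exists (altSum m q p) h low) | subtract (y-exists (p + altSum m q p) low)
  ... | x , e₁ | y , e₂ = _ , _ , keep {x = x} {y} a<u b<v h e₁ e₂ R

  private
    flip-context : ∀ {a b p q} → 1 ≤ p + q → a + p ≤ b → a < b + q
    flip-context {a} {b} {p} {q} h₁ h₂ = lin 0 (h₁ ⊕ h₂) (solve (a ∷ b ∷ p ∷ q ∷ []))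

    swap-1≤ : ∀ p {q} → 1 ≤ p + q → 1 ≤ q + p
    swap-1≤ p {q} h = subst (1 ≤_) (+-comm p q) h

    switch-x : ∀ {x m b v u p} T → x + m < b + T → b < v → v < u + p → x + suc m < u + (p + T)
    switch-x {x} {m} {b} {v} {u} {p} T h₁ h₂ h₃ =
      lin 1 (h₁ ⊕ h₂ ⊕ h₃) (solve (x ∷ m ∷ b ∷ v ∷ u ∷ p ∷ T ∷ []))

    switch-y₁ : ∀ {y m b v T} → y + T ≡ b + m → b < v → y + T < v + m
    switch-y₁ {y} {m} {b} {v} {T} e h =
      lin 0 (≤-reflexive e ⊕ h) (solve (y ∷ m ∷ b ∷ v ∷ T ∷ []))

    switch-y₂ : ∀ {y₁ y₂ m a b p} T → a + p ≤ b → y₁ + (p + T) ≡ b + suc m → y₂ + T ≡ a + m → y₂ < y₁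
    switch-y₂ {y₁} {y₂} {m} {a} {b} {p} T h e₁ e₂ =
      lin 0 (h ⊕ ≡⇒≥ e₁ ⊕ ≤-reflexive e₂) (solve (y₁ ∷ y₂ ∷ m ∷ a ∷ b ∷ p ∷ T ∷ []))

    cancel-< : ∀ {y y₂ T s} → y + T < s → y₂ + T ≡ s → y < y₂
    cancel-< {y} {y₂} {T} h refl = +-cancelʳ-< T y y₂ h

  -- A kept column shifts along with the rest of its rows. At a switch, `y₂ < y₁` is equivalent to
  -- `a + p ≤ b`, while `X` passes from entries of `A` to entries of `B`; there it still decreases
  -- because the preceding column was not a hit, which is the hypothesis `v < u + p`. After a switch
  -- the same hypothesis for the exchanged rows reads `a < b + q` and follows from `1 ≤ p + q`.
  reflection-decreasing : ∀ {m p q u v A B X Y} → 1 ≤ p + q → v < u + p →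
    Reflection m p q u v A B X Y →
    Decreasing (λ x → x + m < u + altSum m p q) X × Decreasing (λ y → y + altSum m p q < v + m) Y
  reflection-decreasing {v = v} _ _ (done As Bs) =
      mapDec (λ {x} → +-monoˡ-< 0) As , mapDec (λ {x} → +-monoˡ-< 0) Bs
  reflection-decreasing {suc m} {p} {q} {u} pq ctx (switch {y₁ = y₁} a<u b<v h e₁ e₂ R)
    with reflection-decreasing (swap-1≤ p pq) (flip-context pq h) R
  ... | Xs , Ys =
      mapDec (λ {x} l → switch-x {u = u} (altSum m q p) l b<v ctx) Xs
    , switch-y₁ {y₁} e₁ b<v ▸ switch-y₂ (altSum m q p) h e₁ e₂ ▸ mapDec (λ l → cancel-< l e₂) Ys
  reflection-decreasing {suc m} {p} {q} pq ctx (keep {x = x} {y = y} a<u b<v h e₁ e₂ R)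
    with reflection-decreasing pq h R
  ... | Xs , Ys =
      switch-y₁ {x} {altSum (suc m) p q} {T = suc m} e₁ a<u ▸ mapDec (λ l → cancel-< l e₁) Xs
    , switch-y₁ {y} e₂ b<v ▸ mapDec (λ l → cancel-< l e₂) Ys

  private
    big-head : ∀ {y L l m} → L ≤ y → suc L ≡ l + (suc m + suc m) → suc (m + m) ≤ y
    big-head {y} {L} {l} {m} h e = lin l (h ⊕ ≡⇒≥ e) (solve (y ∷ L ∷ l ∷ m ∷ []))

    big-head₂ : ∀ {y L l m} → L ≤ y → suc (suc L) ≡ l + (suc m + suc m) → m ≤ y
    big-head₂ {y} {L} {l} {m} h e = lin (l + m) (h ⊕ ≡⇒≥ e) (solve (y ∷ L ∷ l ∷ m ∷ []))

    un-suc₂ : ∀ {L l m} → suc (suc L) ≡ l + (suc m + suc m) → L ≡ l + (m + m)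
    un-suc₂ {L} {l} {m} e = eqn e (solve (L ∷ l ∷ m ∷ []))

    b-exists : ∀ {y m} T → suc (m + m) ≤ y → suc m ≤ y + T
    b-exists {y} {m} T h = lin (m + T) h (solve (y ∷ m ∷ T ∷ []))

    a-exists : ∀ {x y m p} T → suc (m + m) ≤ y → suc (y + (p + T) + (p + T)) ≤ x + suc m + suc m + p →
               p + T ≤ x + suc m
    a-exists {x} {y} {m} {p} T h₁ h₂ = lin (T + m + 1) (h₁ ⊕ h₂) (solve (x ∷ y ∷ m ∷ p ∷ T ∷ []))

    b<v : ∀ {b y m v T} → b + m ≡ y + T → y + T < v + m → b < v
    b<v {b} {y} {m} {v} {T} e h = lin 0 (≤-reflexive e ⊕ h) (solve (b ∷ y ∷ m ∷ v ∷ T ∷ []))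

    a≤b : ∀ {a b p y₁ y₂ m} T → y₂ < y₁ → b + suc m ≡ y₁ + (p + T) → a + m ≡ y₂ + T → a + p ≤ b
    a≤b {a} {b} {p} {y₁} {y₂} {m} T h e₁ e₂ =
      lin 0 (h ⊕ ≡⇒≥ e₁ ⊕ ≤-reflexive e₂) (solve (a ∷ b ∷ p ∷ y₁ ∷ y₂ ∷ m ∷ T ∷ []))

    a<u : ∀ {a b p u v} → a + p ≤ b → b < v → v < u + p → a < u
    a<u {a} {b} {p} {u} {v} h₁ h₂ h₃ = lin 1 (h₁ ⊕ h₂ ⊕ h₃) (solve (a ∷ b ∷ p ∷ u ∷ v ∷ []))

    x-bound : ∀ {x y b m p} T → x + suc m + suc m + p ≤ y + (p + T) + (p + T) → b + suc m ≡ y + (p + T) →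
              x + m < b + T
    x-bound {x} {y} {b} {m} {p} T h e = lin 0 (h ⊕ ≡⇒≥ e) (solve (x ∷ y ∷ b ∷ m ∷ p ∷ T ∷ []))

    b<a+p : ∀ {a b x y p m} T → y + T + T < x + m + m + p → a + T ≡ x + m → b + m ≡ y + T → b < a + p
    b<a+p {a} {b} {x} {y} {p} {m} T h e₁ e₂ =
      lin 0 (h ⊕ ≡⇒≥ e₁ ⊕ ≤-reflexive e₂) (solve (a ∷ b ∷ x ∷ y ∷ p ∷ m ∷ T ∷ []))

    relax : ∀ {z y T s} → y + T ≡ s → z < y → z + T < s
    relax {z} {y} {T} refl h = +-monoˡ-< T h

    -- Shared by the two situations that locate an exchange: `X` is exhausted, or its head fails the
    -- test. The recursive call is an argument, so that the termination checker sees it applied to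
    -- shorter lists at both uses.
    unreflect-switch : ∀ {m p q u v y₁ y₂ X Y} → 1 ≤ p + q → v < u + p →
      Decreasing (λ y → y + altSum (suc m) p q < v + suc m) (y₁ ∷ y₂ ∷ Y) →
      length (y₁ ∷ y₂ ∷ Y) ≡ length X + (suc m + suc m) →
      (∀ {b} → b + suc m ≡ y₁ + altSum (suc m) p q → Decreasing (λ x → x + m < b + altSum m q p) X) →
      (∀ {b a} → a < b + q →
        Decreasing (λ x → x + m < b + altSum m q p) X →
        Decreasing (λ y → y + altSum m q p < a + m) Y →
        length Y ≡ length X + (m + m) → ∃₂ λ A B → Reflection m q p b a A B X Y) →
      ∃₂ λ A B → Reflection (suc m) p q u v A B X (y₁ ∷ y₂ ∷ Y)
    unreflect-switch {m} {p} {q} {y₁ = y₁} {y₂} {X} {Y} pq ctx (k₁ ▸ k₂ ▸ Ys) len Xs rec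
      with subtract (b-exists (altSum (suc m) p q)
             (big-head (length≤ {u = y₁} (k₂ ▸ Ys)) len))
         | subtract {y₂ + altSum m q p} {m}
             (≤-trans (big-head₂ {l = length X} (length≤ Ys) len) (m≤m+n y₂ _))
    ... | b , e₁ | a , e₂
      with rec {b} {a} (flip-context pq h) (Xs e₁) (mapDec (λ l → relax (sym e₂) l) Ys) (un-suc₂ {l = length X} len)
      where h = a≤b {y₁ = y₁} (altSum m q p) k₂ e₁ e₂
    ... | B , A , R = _ , _ , switch (a<u h bv ctx) bv h (sym e₁) (sym e₂) R
      where h = a≤b {y₁ = y₁} (altSum m q p) k₂ e₁ e₂
            bv = b<v {y = y₁} e₁ k₁

  -- A kept column has y + altSum - m < x + m - altSum + p, and a column after which the
  -- tails were exchanged violates this; so the first violation locates the exchange.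
  unreflect : ∀ m p q {u v} X Y → 1 ≤ p + q → v < u + p →
    Decreasing (λ x → x + m < u + altSum m p q) X →
    Decreasing (λ y → y + altSum m p q < v + m) Y →
    length Y ≡ length X + (m + m) →
    ∃₂ λ A B → Reflection m p q u v A B X Y
  unreflect zero p q {u} {v} X Y _ _ Xs Ys _ =
    _ , _ , done (mapDec (λ {x} → +-cancelʳ-< 0 x u) Xs) (mapDec (λ {x} → +-cancelʳ-< 0 x v) Ys)
  unreflect (suc m) p q [] (y₁ ∷ []) _ _ _ _ len with trans (cong pred len) (+-suc m m)
  ... | ()
  unreflect (suc m) p q [] (y₁ ∷ y₂ ∷ Y) pq ctx Xs Ys len =
    unreflect-switch pq ctx Ys len (λ _ → end) (λ {b} {a} → unreflect m q p {b} {a} [] Y (swap-1≤ p pq))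
  unreflect (suc m) p q (x ∷ X) (y ∷ Y) pq ctx (k ▸ Xs) (l ▸ Ys) len
    with suc (y + altSum (suc m) p q + altSum (suc m) p q) ≤? x + suc m + suc m + p
  unreflect (suc m) p q {u} {v} (x ∷ X) (y ∷ Y) pq ctx (k ▸ Xs) (l ▸ Ys) len | yes h
    -- Nonnegativity of the original entries: more than `m + m` entries of `Y` lie strictly below
    -- `y`, which makes `y` large enough for `b`; the test `h` transfers this to `x` and hence to
    -- `a`.
    with subtract (a-exists {x} (altSum m q p) (big-head {l = suc (length X)} (length≤ Ys) len) h)
       | subtract {y + altSum (suc m) p q} {suc m}
           (b-exists (altSum (suc m) p q) (big-head {l = suc (length X)} (length≤ Ys) len))
  ... | a , e₁ | b , e₂
    with unreflect (suc m) p q {a} {b} X Y pq c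
           (mapDec (relax (sym e₁)) Xs) (mapDec (relax (sym e₂)) Ys) (cong pred len)
    where c = b<a+p {a} {b} {x} {y} (altSum (suc m) p q) h e₁ e₂
  ... | A , B , R =
    _ , _ , keep (b<v {y = x} e₁ k) (b<v {y = y} e₂ l)
              (b<a+p {a} {b} {x} {y} (altSum (suc m) p q) h e₁ e₂) (sym e₁) (sym e₂) R
  unreflect (suc m) p q (x ∷ X) (y ∷ []) pq ctx (k ▸ Xs) (l ▸ Ys) len | no h with cong pred len
  ... | e with trans e (+-suc (length X) _)
  ... | ()
  unreflect (suc m) p q (x ∷ X) (y ∷ y₂ ∷ Y) pq ctx (k ▸ Xs) Ys len | no h =
    unreflect-switch pq ctx Ys len
      (λ {b} e → x-bound {x} {y} {b} (altSum m q p) (≤-pred (≰⇒> h)) e ▸ Xs)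
      (λ {b} {a} → unreflect m q p {b} {a} (x ∷ X) Y (swap-1≤ p pq))

  reflection-functional : ∀ {m p q u v u′ v′ A B X Y X′ Y′} →
    Reflection m p q u v A B X Y → Reflection m p q u′ v′ A B X′ Y′ → X ≡ X′ × Y ≡ Y′
  reflection-functional (done _ _) (done _ _) = refl , refl
  reflection-functional {suc m} {p} {q} (switch {y₁ = y₁} {y₂} _ _ _ e₁ e₂ R) (switch {y₁ = y₁′} {y₂′} _ _ _ e₁′ e₂′ R′)
    with reflection-functional R R′
       | +-cancelʳ-≡ _ y₁ y₁′ (trans e₁ (sym e₁′)) | +-cancelʳ-≡ _ y₂ y₂′ (trans e₂ (sym e₂′))
  ... | refl , refl | refl | refl = refl , refl
  reflection-functional (switch _ _ h _ _ _) (keep _ _ h′ _ _ _) = ⊥-elim (<⇒≱ h′ h)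
  reflection-functional (keep _ _ h′ _ _ _) (switch _ _ h _ _ _) = ⊥-elim (<⇒≱ h′ h)
  reflection-functional {suc m} (keep {x = x} {y} _ _ _ e₁ e₂ R) (keep {x = x′} {y′} _ _ _ e₁′ e₂′ R′)
    with reflection-functional R R′
       | +-cancelʳ-≡ (suc m) x x′ (trans e₁ (sym e₁′)) | +-cancelʳ-≡ _ y y′ (trans e₂ (sym e₂′))
  ... | refl , refl | refl | refl = refl , refl

  private
    clash : ∀ {b y a m p x b′} T → y + (p + T) ≡ b + suc m → y + (p + T) ≡ b′ + suc m → x + m < b + T →
      x + suc m ≡ a + (p + T) → b′ < a + p → ⊥
    clash {b} {y} {a} {m} {p} {x} {b′} T e₁ e₂ h₁ e₃ h₂ = <-irrefl refl
      (lin {u = suc 0} {v = 0} 0 (≡⇒≥ e₁ ⊕ ≤-reflexive e₂ ⊕ h₁ ⊕ ≡⇒≥ e₃ ⊕ h₂)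
        (solve (b ∷ y ∷ a ∷ m ∷ p ∷ x ∷ b′ ∷ T ∷ [])))

  -- A switch and a keep cannot have the same output: after a switch the head of `X` comes from an
  -- entry below `b`, so it is too small to satisfy the inequality of a kept column.
  reflection-injective : ∀ {m p q u v u′ v′ A B A′ B′ X Y} → 1 ≤ p + q →
    Reflection m p q u v A B X Y → Reflection m p q u′ v′ A′ B′ X Y → A ≡ A′ × B ≡ B′
  reflection-injective _ (done _ _) (done _ _) = refl , refl
  reflection-injective {suc m} {p} {q} pq (switch {a = a} {b} _ _ _ e₁ e₂ R) (switch {a = a′} {b′} _ _ _ e₁′ e₂′ R′)
    with reflection-injective (swap-1≤ p pq) R R′
       | +-cancelʳ-≡ _ b b′ (trans (sym e₁) e₁′) | +-cancelʳ-≡ _ a a′ (trans (sym e₂) e₂′)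
  ... | refl , refl | refl | refl = refl , refl
  reflection-injective {suc m} {p} {q} pq (switch _ _ h e₁ _ R) (keep {a = a} {x = x} {y} _ _ h′ e₁′ e₂′ _)
    with reflection-decreasing (swap-1≤ p pq) (flip-context pq h) R
  ... | (k ▸ _) , _ = ⊥-elim (clash {y = y} {a} {x = x} (altSum m q p) e₁ e₂′ k e₁′ h′)
  reflection-injective {suc m} {p} {q} pq (keep {a = a} {x = x} {y} _ _ h′ e₁′ e₂′ _) (switch _ _ h e₁ _ R)
    with reflection-decreasing (swap-1≤ p pq) (flip-context pq h) R
  ... | (k ▸ _) , _ = ⊥-elim (clash {y = y} {a} {x = x} (altSum m q p) e₁ e₂′ k e₁′ h′)
  reflection-injective {suc m} pq (keep {a = a} {b} _ _ _ e₁ e₂ R) (keep {a = a′} {b′} _ _ _ e₁′ e₂′ R′)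
    with reflection-injective pq R R′
       | +-cancelʳ-≡ _ a a′ (trans (sym e₁) e₁′) | +-cancelʳ-≡ _ b b′ (trans (sym e₂) e₂′)
  ... | refl , refl | refl | refl = refl , refl

  reflection⇒oscillates : ∀ {m p q u v A B X Y} → Reflection m p q u v A B X Y → Oscillates m p q A B
  reflection⇒oscillates (done _ _)           = done
  reflection⇒oscillates (switch _ _ h _ _ R) = here h (reflection⇒oscillates R)
  reflection⇒oscillates (keep _ _ h _ _ R)   = skip h (reflection⇒oscillates R)

  reflection-decreasing⁻ : ∀ {m p q u v A B X Y} → Reflection m p q u v A B X Y →
    Decreasing (_< u) A × Decreasing (_< v) B
  reflection-decreasing⁻ (done As Bs) = As , Bs
  reflection-decreasing⁻ (switch a<u b<v _ _ _ R) with reflection-decreasing⁻ R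
  ... | Bs , As = (a<u ▸ As) , (b<v ▸ Bs)
  reflection-decreasing⁻ (keep a<u b<v _ _ _ R) with reflection-decreasing⁻ R
  ... | As , Bs = (a<u ▸ As) , (b<v ▸ Bs)

  -- Lengths and sums under the exchanges

  private
    switch-charge : ∀ x y m → y ≡ x + (m + m) → suc (suc y) ≡ x + (suc m + suc m)
    switch-charge x y m e = eqn e (solve (x ∷ y ∷ m ∷ []))

  reflection-length : ∀ {m p q u v A B X Y} → Reflection m p q u v A B X Y →
    length A ≡ length B → length X + m ≡ length A
  reflection-length (done _ _) _ = +-identityʳ _
  reflection-length (switch {X = X} _ _ _ _ _ R) e =
    trans (+-suc (length X) _) (trans (cong suc (reflection-length R (sym (suc-injective e)))) (sym e))
  reflection-length (keep _ _ _ _ _ R) e = cong suc (reflection-length R (suc-injective e))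

  reflection-charge : ∀ {m p q u v A B X Y} → Reflection m p q u v A B X Y →
    length A ≡ length B → length Y ≡ length X + (m + m)
  reflection-charge (done _ _) e = trans (sym e) (sym (+-identityʳ _))
  reflection-charge (switch {m} {X = X} {Y} _ _ _ _ _ R) e =
    switch-charge (length X) (length Y) m (reflection-charge R (sym (suc-injective e)))
  reflection-charge (keep _ _ _ _ _ R) e = cong suc (reflection-charge R (suc-injective e))

  reflection-charge⁻ : ∀ {m p q u v A B X Y} → Reflection m p q u v A B X Y →
    length Y ≡ length X + (m + m) → length A ≡ length B
  reflection-charge⁻ (done _ _) e = sym (trans e (+-identityʳ _))
  reflection-charge⁻ (switch {X = X} _ _ _ _ _ R) e =
    cong suc (sym (reflection-charge⁻ R (un-suc₂ {l = length X} e)))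
  reflection-charge⁻ (keep _ _ _ _ _ R) e = cong suc (reflection-charge⁻ R (suc-injective e))

  -- A kept column has `x + y = a + b`. A hit with `m` hits after it has `y₁ + y₂ = a + b + (2m + 1)
  -- - (p + 2 altSum m q p)`. The odd numbers add up to the `m * m` of `reflection-sum`; the
  -- subtracted terms are collected here.
  weight : ℕ → ℕ → ℕ → ℕ
  weight zero    p q = 0
  weight (suc m) p q = p + (altSum m q p + altSum m q p + weight m q p)

  private
    switch-sum : ∀ {y₁ y₂ a b m p} T W sA sB sX sY → y₁ + (p + T) ≡ b + suc m → y₂ + T ≡ a + m →
      sX + sY + W ≡ sB + sA + m * m →
      sX + (y₁ + (y₂ + sY)) + (p + (T + T + W)) ≡ (a + sA) + (b + sB) + suc m * suc m
    switch-sum {y₁} {y₂} {a} {b} {m} {p} T W sA sB sX sY e₁ e₂ e₃ =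
      eqn (e₁ ⊞ e₂ ⊞ e₃) (solve (y₁ ∷ y₂ ∷ a ∷ b ∷ m ∷ p ∷ T ∷ W ∷ sA ∷ sB ∷ sX ∷ sY ∷ []))

    keep-sum : ∀ {x y a b m} T W M sA sB sX sY → x + m ≡ a + T → y + T ≡ b + m →
      sX + sY + W ≡ sA + sB + M → (x + sX) + (y + sY) + W ≡ (a + sA) + (b + sB) + M
    keep-sum {x} {y} {a} {b} {m} T W M sA sB sX sY e₁ e₂ e₃ =
      eqn (e₁ ⊞ e₂ ⊞ e₃) (solve (x ∷ y ∷ a ∷ b ∷ m ∷ T ∷ W ∷ M ∷ sA ∷ sB ∷ sX ∷ sY ∷ []))

  reflection-sum : ∀ {m p q u v A B X Y} → Reflection m p q u v A B X Y →
    sum X + sum Y + weight m p q ≡ sum A + sum B + m * m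
  reflection-sum (done _ _) = refl
  reflection-sum (switch {m} {p} {q} {a = a} {b} {y₁} {y₂} {A} {B} {X} {Y} _ _ _ e₁ e₂ R) =
    switch-sum {y₁} {y₂} {a} {b} {m} {p} (altSum m q p) (weight m q p) (sum A) (sum B) (sum X) (sum Y) e₁ e₂ (reflection-sum R)
  reflection-sum (keep {m} {p} {q} {a = a} {b} {x} {y} {A} {B} {X} {Y} _ _ _ e₁ e₂ R) =
    keep-sum {x} {y} {a} {b} {suc m} (altSum (suc m) p q) (weight (suc m) p q) (suc m * suc m)
      (sum A) (sum B) (sum X) (sum Y) e₁ e₂ (reflection-sum R)

  -- Partitions as pairs of strictly decreasing lists

  data PartsBelow : ℕ → List ℕ → Set where
    none : ∀ {t} → PartsBelow t []
    part : ∀ {t l ls} → suc l ≤ t → PartsBelow (suc l) ls → PartsBelow t (suc l ∷ ls)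

  addColumn : ℕ → List ℕ → List ℕ
  addColumn zero    _        = []
  addColumn (suc b) []       = 1 ∷ addColumn b []
  addColumn (suc b) (r ∷ rs) = suc r ∷ addColumn b rs

  -- After a part 1 all further parts of a partition are 1 and vanish as well, so the last clause
  -- may drop the whole tail.
  removeColumn : List ℕ → List ℕ
  removeColumn (suc (suc r) ∷ rs) = suc r ∷ removeColumn rs
  removeColumn _                  = []

  length-addColumn : ∀ b rs → length (addColumn b rs) ≡ b
  length-addColumn zero    _        = refl
  length-addColumn (suc b) []       = cong suc (length-addColumn b [])
  length-addColumn (suc b) (r ∷ rs) = cong suc (length-addColumn b rs)

  sum-addColumn : ∀ b rs → length rs ≤ b → sum (addColumn b rs) ≡ b + sum rs
  sum-addColumn zero    []       _       = refl
  sum-addColumn (suc b) []       _       = cong suc (sum-addColumn b [] z≤n)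
  sum-addColumn (suc b) (r ∷ rs) (s≤s h) =
    trans (cong (suc r +_) (sum-addColumn b rs h)) (reorder r b (sum rs))
    where
    reorder : ∀ r b s → suc r + (b + s) ≡ suc b + (r + s)
    reorder r b s = solve (r ∷ b ∷ s ∷ [])

  addColumn-parts : ∀ b {t rs} → PartsBelow t rs → PartsBelow (suc t) (addColumn b rs)
  addColumn-parts zero    _          = none
  addColumn-parts (suc b) none       = part (s≤s z≤n) (addColumn-parts b {0} none)
  addColumn-parts (suc b) (part h P) = part (s≤s h) (addColumn-parts b P)

  removeColumn-parts : ∀ {t rs} → PartsBelow (suc t) rs → PartsBelow t (removeColumn rs)
  removeColumn-parts none                            = none
  removeColumn-parts (part {l = zero}  _ _)          = none
  removeColumn-parts (part {l = suc l} (s≤s h) P)    = part h (removeColumn-parts P)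

  removeColumn-addColumn : ∀ b {t rs} → PartsBelow t rs → length rs ≤ b → removeColumn (addColumn b rs) ≡ rs
  removeColumn-addColumn zero    none       _       = refl
  removeColumn-addColumn (suc b) none       _       = refl
  removeColumn-addColumn (suc b) (part _ P) (s≤s h) = cong (_ ∷_) (removeColumn-addColumn b P h)

  addColumn-removeColumn : ∀ {t rs} → PartsBelow t rs → addColumn (length rs) (removeColumn rs) ≡ rs
  addColumn-removeColumn none                  = refl
  addColumn-removeColumn (part {l = suc l} _ P) = cong (_ ∷_) (addColumn-removeColumn P)
  addColumn-removeColumn (part {l = zero} _ P) = cong (1 ∷_) (ones P)
    where
    ones : ∀ {rs} → PartsBelow 1 rs → addColumn (length rs) [] ≡ rs
    ones none                      = refl
    ones (part {l = zero} _ P)     = cong (1 ∷_) (ones P)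
    ones (part {l = suc l} (s≤s ()) _)

  length-removeColumn : ∀ rs → length (removeColumn rs) ≤ length rs
  length-removeColumn []                 = z≤n
  length-removeColumn (zero ∷ rs)        = z≤n
  length-removeColumn (suc zero ∷ rs)    = z≤n
  length-removeColumn (suc (suc r) ∷ rs) = s≤s (length-removeColumn rs)

  -- The β-numbers of the partition padded with zeros to `d` parts; the empty partition gives
  -- `d - 1, ..., 0`.
  beta : ℕ → List ℕ → List ℕ
  beta zero    _        = []
  beta (suc d) []       = d ∷ beta d []
  beta (suc d) (l ∷ ls) = (l + d) ∷ beta d ls

  triangle : ℕ → ℕ
  triangle zero    = 0
  triangle (suc d) = d + triangle d

  length-beta : ∀ d ls → length (beta d ls) ≡ d
  length-beta zero    _        = refl
  length-beta (suc d) []       = cong suc (length-beta d [])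
  length-beta (suc d) (l ∷ ls) = cong suc (length-beta d ls)

  sum-beta : ∀ d ls → length ls ≤ d → sum (beta d ls) ≡ sum ls + triangle d
  sum-beta zero    []       _       = refl
  sum-beta (suc d) []       _       = cong (d +_) (sum-beta d [] z≤n)
  sum-beta (suc d) (l ∷ ls) (s≤s h) =
    trans (cong (l + d +_) (sum-beta d ls h)) (reorder l d (sum ls) (triangle d))
    where
    reorder : ∀ l d s t → l + d + (s + t) ≡ l + s + (d + t)
    reorder l d s t = solve (l ∷ d ∷ s ∷ t ∷ [])

  beta-decreasing : ∀ d {t ls} → PartsBelow t ls → Decreasing (_< t + d) (beta d ls)
  beta-decreasing zero    _          = end
  beta-decreasing (suc d) {t} none   = m≤n+m (suc d) t ▸ beta-decreasing d none
  beta-decreasing (suc d) {t} (part {l = l} h P) = bound t l d h ▸ beta-decreasing d P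
    where
    bound : ∀ t l d → suc l ≤ t → suc l + d < t + suc d
    bound t l d h = lin 0 h (solve (t ∷ l ∷ d ∷ []))

  beta-injective : ∀ d {t t′ ls ls′} → PartsBelow t ls → PartsBelow t′ ls′ → length ls ≤ d → length ls′ ≤ d →
    beta d ls ≡ beta d ls′ → ls ≡ ls′
  beta-injective _ none none _ _ _ = refl
  beta-injective (suc d) none (part {l = l} _ _) _ _ e = ⊥-elim (m≢1+n+m d (proj₁ (∷-injective e)))
  beta-injective (suc d) (part {l = l} _ _) none _ _ e = ⊥-elim (m≢1+n+m d (sym (proj₁ (∷-injective e))))
  beta-injective (suc d) (part {l = l} _ P) (part {l = l′} _ P′) (s≤s h) (s≤s h′) e with ∷-injective e
  ... | e₁ , e₂ = cong₂ _∷_ (+-cancelʳ-≡ d (suc l) (suc l′) e₁) (beta-injective d P P′ h h′ e₂)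

  beta-surjective : ∀ d {t} Y → Decreasing (_< t + d) Y → length Y ≡ d →
    ∃ λ ls → PartsBelow t ls × length ls ≤ d × beta d ls ≡ Y
  beta-surjective .0       []      _          refl = [] , none , z≤n , refl
  beta-surjective .(suc _) {t} (y ∷ Y) (y<t ▸ Ys) refl with subtract (length≤ Ys)
  ... | l , refl with beta-surjective (length Y) Y Ys refl
  -- The parts of `ls` are at most `l`. If `l` is zero, the padding has begun, and `ls` is empty
  -- too.
  ... | ls , P , h , e with l
  ...   | suc l = _ , part (bound t l (length Y) y<t) P , s≤s h , cong (_ ∷_) e
    where
    bound : ∀ t l d → suc l + d < t + suc d → suc l ≤ t
    bound t l d h = lin 0 h (solve (t ∷ l ∷ d ∷ []))
  beta-surjective .(suc _) (y ∷ Y) _ refl | _ , refl | .[] , none , h , e | zero =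
    [] , none , z≤n , cong (length Y ∷_) e
  beta-surjective .(suc _) (y ∷ Y) _ refl | _ , refl | _ , part () _ , h , e | zero

  -- A pair (Y , X) with length Y = length X + d encodes the partition whose first row and
  -- first column form the hook with arm l = y - d and leg x + d, and so on recursively; the
  -- d entries of Y left over when X is exhausted are the β-numbers of the remaining partition.
  data Hook (d : ℕ) : List ℕ → List ℕ → List ℕ → Set where
    base : ∀ {t ls} → PartsBelow t ls → length ls ≤ d → Hook d ls (beta d ls) []
    hook : ∀ {l x rs Y X} → PartsBelow l rs → length rs ≤ x + d → Hook d rs Y X →
           Hook d (suc l ∷ addColumn (x + d) rs) (l + d ∷ Y) (x ∷ X)

  private
    hook-x : ∀ {μ x d w} → x + d ≡ μ → suc μ ≤ w + d → x < w
    hook-x {μ} {x} {d} {w} refl h = lin 0 h (solve (x ∷ d ∷ w ∷ []))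

    hook-y : ∀ {l d t} → l + d < t + d → suc l ≤ t
    hook-y {l} {d} {t} h = lin 0 h (solve (l ∷ d ∷ t ∷ []))

  -- f is fuel: the recursion removes a row and a column.
  toHooks : ∀ d f {t w} ls → length ls ≤ f → PartsBelow t ls → length ls ≤ w + d →
    ∃₂ λ Y X → Hook d ls Y X × Decreasing (_< t + d) Y × Decreasing (_< w) X
  toHooks d f ls hf P hw with length ls ≤? d
  ... | yes h = _ , _ , base P h , beta-decreasing d P , end
  toHooks d f [] hf P hw | no h = ⊥-elim (h z≤n)
  -- The corner has leg `length μ`, which is at least `d` in this branch; `x` is the excess over
  -- `d`.
  toHooks d (suc f) {t} (suc l ∷ μ) (s≤s hf) (part l<t P) hw | no h with subtract (≤-pred (≰⇒> h))
  ... | x , e with toHooks d f {l} {x} (removeColumn μ) (≤-trans (length-removeColumn μ) hf)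
                   (removeColumn-parts P) (≤-trans (length-removeColumn μ) (≡⇒≥ e))
  ...   | Y , X , H , Ys , Xs = _ , _
    , subst (λ μ′ → Hook d (suc l ∷ μ′) (l + d ∷ Y) (x ∷ X))
        (trans (cong (λ b → addColumn b (removeColumn μ)) e) (addColumn-removeColumn P))
        (hook (removeColumn-parts P) (≤-trans (length-removeColumn μ) (≡⇒≥ e)) H)
    , +-monoˡ-< d l<t ▸ Ys , hook-x e hw ▸ Xs

  fromHooks : ∀ d {t w} Y X → Decreasing (_< t + d) Y → Decreasing (_< w) X → length Y ≡ length X + d →
    ∃ λ ls → Hook d ls Y X × PartsBelow t ls × length ls ≤ w + d
  fromHooks d {w = w} Y [] Ys end len with beta-surjective d Y Ys len
  ... | ls , P , h , refl = ls , base P h , P , ≤-trans h (m≤n+m d w)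
  fromHooks d {t} {w} (y ∷ Y) (x ∷ X) (y<t ▸ Ys) (x<w ▸ Xs) len
    with subtract (≤-trans (m≤n+m d (length X)) (≤-trans (≡⇒≥ (suc-injective len)) (length≤ Ys)))
  ... | l , refl with fromHooks d {l} {x} Y X Ys Xs (suc-injective len)
  ... | rs , H , P , h = _ , hook P h H , part (hook-y y<t) (addColumn-parts (x + d) P)
    , subst (_≤ w + d) (cong suc (sym (length-addColumn (x + d) rs))) (+-monoˡ-< d x<w)

  length-hook : ∀ x rs {d} → d < suc (length (addColumn (x + d) rs))
  length-hook x rs {d} = s≤s (subst (d ≤_) (sym (length-addColumn (x + d) rs)) (m≤n+m d x))

  -- The number of parts tells `base` from `hook` and recovers `x`. The partitions are equated by a
  -- hypothesis, since an index `addColumn (x + d) rs` cannot be unified.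
  hook-functional : ∀ {d ls ls′ Y Y′ X X′} → ls ≡ ls′ → Hook d ls Y X → Hook d ls′ Y′ X′ → Y ≡ Y′ × X ≡ X′
  hook-functional {d} e (base _ _) (base _ _) = cong (beta d) e , refl
  hook-functional {d} e (base _ h) (hook {x = x} {rs} _ _ _) =
    ⊥-elim (<⇒≱ (length-hook x rs) (subst (λ ls → length ls ≤ d) e h))
  hook-functional {d} e (hook {x = x} {rs} _ _ _) (base _ h) =
    ⊥-elim (<⇒≱ (length-hook x rs) (subst (λ ls → length ls ≤ d) (sym e) h))
  hook-functional {d} e (hook {x = x} {rs} P h H) (hook {x = x′} {rs′} P′ h′ H′)
    with ∷-injective e
  ... | refl , e₂
    with +-cancelʳ-≡ d x x′ (trans (sym (length-addColumn (x + d) rs))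
           (trans (cong length e₂) (length-addColumn (x′ + d) rs′)))
  ... | refl
    with hook-functional (trans (sym (removeColumn-addColumn (x + d) P h))
           (trans (cong removeColumn e₂) (removeColumn-addColumn (x + d) P′ h′))) H H′
  ... | refl , refl = refl , refl

  hook-injective : ∀ {d ls ls′ Y Y′ X X′} → Y ≡ Y′ → X ≡ X′ → Hook d ls Y X → Hook d ls′ Y′ X′ → ls ≡ ls′
  hook-injective {d} e _ (base P h) (base P′ h′) = beta-injective d P P′ h h′ e
  hook-injective {d} e refl (hook {l = l} P h H) (hook {l = l′} P′ h′ H′) with ∷-injective e
  ... | e₁ , e₂ with +-cancelʳ-≡ d l l′ e₁ | hook-injective e₂ refl H H′
  ... | refl | refl = refl

  hook-length : ∀ {d ls Y X} → Hook d ls Y X → length Y ≡ length X + d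
  hook-length {d} {ls} (base _ _) = length-beta d ls
  hook-length (hook _ _ H) = cong suc (hook-length H)

  hook-sum : ∀ {d ls Y X} → Hook d ls Y X → sum X + sum Y + length X ≡ sum ls + triangle d
  hook-sum {d} {ls} (base _ h) = trans (+-identityʳ _) (sum-beta d ls h)
  hook-sum {d} (hook {l} {x} {rs} {Y} {X} _ h H) =
    trans (step l d x (sum Y) (sum X) (length X) (sum rs) (triangle d) (hook-sum H))
      (cong (λ s → suc l + s + triangle d) (sym (sum-addColumn (x + d) rs h)))
    where
    step : ∀ l d x Y X n r t → X + Y + n ≡ r + t → (x + X) + (l + d + Y) + suc n ≡ suc l + (x + d + r) + t
    step l d x Y X n r t e = eqn e (solve (l ∷ d ∷ x ∷ Y ∷ X ∷ n ∷ r ∷ t ∷ []))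

  -- Anchors and overlines

  opposite : Sign → Sign
  opposite positive = negative
  opposite negative = positive

  opposite-injective : ∀ s t → opposite s ≡ opposite t → s ≡ t
  opposite-injective positive positive _ = refl
  opposite-injective negative negative _ = refl

  opposite-≢ : ∀ s → opposite s ≢ s
  opposite-≢ positive ()
  opposite-≢ negative ()

  alternate : Sign → ℕ → Sign
  alternate s zero    = s
  alternate s (suc j) = alternate (opposite s) j

  alternate-injective : ∀ j s t → alternate s j ≡ alternate t j → s ≡ t
  alternate-injective zero    s t e = e
  alternate-injective (suc j) s t e = opposite-injective s t (alternate-injective j _ _ e)

  -- Stands in for `lookup`, whose `Fin` index depends on the list; with natural positions, anchors
  -- are easily transported between lists.
  data At {A : Set} : List A → ℕ → A → Set where
    here  : ∀ {x xs} → At (x ∷ xs) 0 x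
    there : ∀ {x y xs j} → At xs j x → At (y ∷ xs) (suc j) x

  At-functional : ∀ {A : Set} {xs : List A} {j x y} → At xs j x → At xs j y → x ≡ y
  At-functional here      here      = refl
  At-functional (there a) (there b) = At-functional a b

  At-pred : ∀ {A : Set} {xs : List A} {j x} → At xs (suc j) x → ∃ (At xs j)
  At-pred {j = zero}  (there here)      = _ , here
  At-pred {j = suc j} (there a)         with At-pred a
  ... | _ , b = _ , there b

  At-lookup : ∀ {A : Set} (xs : List A) j → At xs (toℕ j) (lookup xs j)
  At-lookup (x ∷ xs) Fin.zero    = here
  At-lookup (x ∷ xs) (Fin.suc j) = there (At-lookup xs j)

  lookup-At : ∀ {A : Set} {xs : List A} {j x} → At xs j x → ∃ λ i → toℕ i ≡ j × lookup xs i ≡ x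
  lookup-At here = Fin.zero , refl , refl
  lookup-At (there a) with lookup-At a
  ... | i , e₁ , e₂ = Fin.suc i , cong suc e₁ , e₂

  -- A first block of the wrong sign is passed over, as in case (d), whose dotted blocks
  -- begin at B₂.
  data Alternates : Sign → ℕ → List (Maybe Sign) → Set where
    done : ∀ {s ks} → Alternates s 0 ks
    here : ∀ {s m ks} → Alternates (opposite s) m ks → Alternates s (suc m) (just s ∷ ks)
    skip : ∀ {s m k ks} → k ≢ just s → Alternates s (suc m) ks → Alternates s (suc m) (k ∷ ks)

  just-≢-opposite : ∀ t → just t ≢ just (opposite t)
  just-≢-opposite positive ()
  just-≢-opposite negative ()

  alternates⇒anchor : ∀ p t j ks → Alternates (opposite t) (suc j) ks →
    ∃ λ c → At (anchorsFrom p (just t) ks) j (c , alternate (opposite t) j)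
  alternates⇒anchor p t j (nothing ∷ ks) (skip _ a) = alternates⇒anchor (suc p) t j ks a
  alternates⇒anchor p positive zero (just negative ∷ ks) (here a) = p , here
  alternates⇒anchor p positive (suc j) (just negative ∷ ks) (here a) with alternates⇒anchor (suc p) negative j ks a
  ... | c , b = c , there b
  alternates⇒anchor p positive j (just positive ∷ ks) (skip _ a) = alternates⇒anchor (suc p) positive j ks a
  alternates⇒anchor p positive j (just negative ∷ ks) (skip n a) = ⊥-elim (n refl)
  alternates⇒anchor p negative zero (just positive ∷ ks) (here a) = p , here
  alternates⇒anchor p negative (suc j) (just positive ∷ ks) (here a) with alternates⇒anchor (suc p) positive j ks a
  ... | c , b = c , there b
  alternates⇒anchor p negative j (just negative ∷ ks) (skip _ a) = alternates⇒anchor (suc p) negative j ks a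
  alternates⇒anchor p negative j (just positive ∷ ks) (skip n a) = ⊥-elim (n refl)

  anchor⇒alternates : ∀ p t j ks {c s} → At (anchorsFrom p (just t) ks) j (c , s) →
    Alternates (opposite t) (suc j) ks × s ≡ alternate (opposite t) j
  anchor⇒alternates p t j (nothing ∷ ks) a with anchor⇒alternates (suc p) t j ks a
  ... | b , e = skip (λ ()) b , e
  anchor⇒alternates p positive j (just positive ∷ ks) a with anchor⇒alternates (suc p) positive j ks a
  ... | b , e = skip (λ ()) b , e
  anchor⇒alternates p negative j (just negative ∷ ks) a with anchor⇒alternates (suc p) negative j ks a
  ... | b , e = skip (λ ()) b , e
  anchor⇒alternates p positive .0 (just negative ∷ ks) here = here done , refl
  anchor⇒alternates p positive (suc j) (just negative ∷ ks) (there a) with anchor⇒alternates (suc p) negative j ks a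
  ... | b , e = here b , e
  anchor⇒alternates p negative .0 (just positive ∷ ks) here = here done , refl
  anchor⇒alternates p negative (suc j) (just positive ∷ ks) (there a) with anchor⇒alternates (suc p) positive j ks a
  ... | b , e = here b , e

  sign-dichotomy : ∀ s t → t ≡ s ⊎ s ≡ opposite t
  sign-dichotomy positive positive = inj₁ refl
  sign-dichotomy positive negative = inj₂ refl
  sign-dichotomy negative positive = inj₂ refl
  sign-dichotomy negative negative = inj₁ refl

  -- The alternatives are the two possible signs of the first block. If it is `s`, the last chosen
  -- column lies in the block of index `j` and one overline suffices; otherwise all indices move up
  -- by one, which calls for two overlines.
  alternates⇒dotted : ∀ p s j ks → Alternates s (suc j) ks →
    (∃ λ c → At (anchorsFrom p nothing ks) j (c , alternate s j)) ⊎
    (∃ λ c → At (anchorsFrom p nothing ks) (suc j) (c , alternate s j))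
  alternates⇒dotted p s j (nothing ∷ ks) (skip _ a) = alternates⇒dotted (suc p) s j ks a
  alternates⇒dotted p s zero (just .s ∷ ks) (here a) = inj₁ (p , here)
  alternates⇒dotted p s (suc j) (just .s ∷ ks) (here a) with alternates⇒anchor (suc p) s j ks a
  ... | c , b = inj₁ (c , there b)
  alternates⇒dotted p s j (just t ∷ ks) (skip n a) with sign-dichotomy s t
  ... | inj₁ refl = ⊥-elim (n refl)
  ... | inj₂ refl with alternates⇒anchor (suc p) t j ks a
  ...   | c , b = inj₂ (c , there b)

  -- Signs of blocks alternate, so the sign found at the given index determines that of the first
  -- block, and with it whether that block is skipped.
  dotted⇒alternates : ∀ p s j ks {c} →
    At (anchorsFrom p nothing ks) j (c , alternate s j) ⊎
    At (anchorsFrom p nothing ks) (suc j) (c , alternate s j) → Alternates s (suc j) ks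
  dotted⇒alternates p s j [] (inj₁ ())
  dotted⇒alternates p s j [] (inj₂ ())
  dotted⇒alternates p s j (nothing ∷ ks) a = skip (λ ()) (dotted⇒alternates (suc p) s j ks a)
  dotted⇒alternates p s zero (just .s ∷ ks) (inj₁ here) = here done
  dotted⇒alternates p s (suc j) (just t ∷ ks) (inj₁ (there a)) with anchor⇒alternates (suc p) t j ks a
  ... | b , e with opposite-injective s t (alternate-injective j _ _ e)
  ...   | refl = here b
  dotted⇒alternates p s j (just t ∷ ks) (inj₂ (there a)) with anchor⇒alternates (suc p) t j ks a
  ... | b , e with alternate-injective j s (opposite t) e
  ...   | refl = skip (just-≢-opposite t) b

  anchors-alternate : ∀ p l j ks {c s c′ s′} → At (anchorsFrom p l ks) j (c , s) →
    At (anchorsFrom p l ks) (suc j) (c′ , s′) → s′ ≢ s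
  anchors-alternate p nothing j (nothing ∷ ks) a b = anchors-alternate (suc p) nothing j ks a b
  anchors-alternate p nothing zero (just t ∷ ks) here (there b) e
    with anchor⇒alternates (suc p) t 0 ks b
  ... | _ , e′ = opposite-≢ t (trans (sym e′) e)
  anchors-alternate p nothing (suc j) (just t ∷ ks) (there a) (there b) = anchors-alternate (suc p) (just t) j ks a b
  anchors-alternate p (just t) j ks a b e
    with anchor⇒alternates p t j ks a | anchor⇒alternates p t (suc j) ks b
  ... | _ , refl | _ , refl = opposite-≢ (opposite t) (alternate-injective j _ _ e)

  anchor-position : ∀ p l j ks {c s} → At (anchorsFrom p l ks) j (c , s) → p ≤ c × c < p + length ks
  anchor-position p l j (k ∷ ks) {c} a = subst (λ z → p ≤ c × c < z) (sym (+-suc p (length ks))) (go l k j a)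
    where
    later : ∀ {l j s} → At (anchorsFrom (suc p) l ks) j (c , s) → p ≤ c × c < suc (p + length ks)
    later {l} {j} a with anchor-position (suc p) l j ks a
    ... | h₁ , h₂ = <⇒≤ h₁ , h₂
    first : p ≤ p × p < suc (p + length ks)
    first = ≤-refl , s≤s (m≤m+n p _)
    go : ∀ l k j {s} → At (anchorsFrom p l (k ∷ ks)) j (c , s) → p ≤ c × c < suc (p + length ks)
    go l nothing j a = later {l} a
    go nothing (just t) .0 here = first
    go nothing (just t) (suc j) (there a) = later {just t} a
    go (just positive) (just positive) j a = later {just positive} a
    go (just negative) (just negative) j a = later {just negative} a
    go (just positive) (just negative) .0 here = first
    go (just negative) (just positive) .0 here = first
    go (just positive) (just negative) (suc j) (there a) = later {just negative} a
    go (just negative) (just positive) (suc j) (there a) = later {just positive} a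

  anchors-increase : ∀ p l j ks {c s c′ s′} → At (anchorsFrom p l ks) j (c , s) →
    At (anchorsFrom p l ks) (suc j) (c′ , s′) → c < c′
  anchors-increase p l j (nothing ∷ ks) a b = anchors-increase (suc p) l j ks a b
  anchors-increase p nothing zero (just t ∷ ks) here (there b) = proj₁ (anchor-position (suc p) (just t) 0 ks b)
  anchors-increase p nothing (suc j) (just t ∷ ks) (there a) (there b) = anchors-increase (suc p) (just t) j ks a b
  anchors-increase p (just positive) j (just positive ∷ ks) a b = anchors-increase (suc p) (just positive) j ks a b
  anchors-increase p (just negative) j (just negative ∷ ks) a b = anchors-increase (suc p) (just negative) j ks a b
  anchors-increase p (just positive) zero (just negative ∷ ks) here (there b) =
    proj₁ (anchor-position (suc p) (just negative) 0 ks b)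
  anchors-increase p (just negative) zero (just positive ∷ ks) here (there b) =
    proj₁ (anchor-position (suc p) (just positive) 0 ks b)
  anchors-increase p (just positive) (suc j) (just negative ∷ ks) (there a) (there b) =
    anchors-increase (suc p) (just negative) j ks a b
  anchors-increase p (just negative) (suc j) (just positive ∷ ks) (there a) (there b) =
    anchors-increase (suc p) (just positive) j ks a b

  -- Overlines and their positions

  overlinedFrom-positions : ∀ p cs → All (λ e → p ≤ proj₁ e) (overlinedFrom p cs)
  overlinedFrom-positions p [] = All.[]
  overlinedFrom-positions p (col _ _ t b ∷ cs) = prepend t (prepend b (All.map <⇒≤ (overlinedFrom-positions (suc p) cs)))
    where
    prepend : ∀ x {r es} → All (λ e → p ≤ proj₁ e) es →
              All (λ e → p ≤ proj₁ e) ((if x then (p , r) ∷ [] else []) ++ es)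
    prepend true  as = ≤-refl All.∷ as
    prepend false as = as

  marked-injective : ∀ {A : Set} {e : A} x x′ {es es′} → All (_≢ e) es → All (_≢ e) es′ →
    (if x then e ∷ [] else []) ++ es ≡ (if x′ then e ∷ [] else []) ++ es′ → x ≡ x′ × es ≡ es′
  marked-injective true  true  _ _ refl = refl , refl
  marked-injective false false _ _ e    = refl , e
  marked-injective true  false {es′ = _ ∷ _} _ (n All.∷ _) refl = ⊥-elim (n refl)
  marked-injective false true  {es = _ ∷ _} (n All.∷ _) _ refl = ⊥-elim (n refl)

  -- Overlines of later columns have larger positions, and those of one column differ in their row,
  -- so the flags can be read off the list from the left.
  overlinedFrom-injective : ∀ p cs cs′ → map top cs ≡ map top cs′ → map bot cs ≡ map bot cs′ →
    overlinedFrom p cs ≡ overlinedFrom p cs′ → cs ≡ cs′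
  overlinedFrom-injective p [] [] _ _ _ = refl
  overlinedFrom-injective p (col _ _ t b ∷ cs) (col _ _ t′ b′ ∷ cs′) ta ba e with ∷-injective ta | ∷-injective ba
  ... | refl , ta′ | refl , ba′
    with marked-injective t t′ (noTop b cs) (noTop b′ cs′) e
    where
    noTop : ∀ x cs → All (_≢ (p , topRow)) ((if x then (p , botRow) ∷ [] else []) ++ overlinedFrom (suc p) cs)
    noTop true  cs = (λ ()) All.∷ All.map (λ { h refl → <-irrefl refl h }) (overlinedFrom-positions (suc p) cs)
    noTop false cs = All.map (λ { h refl → <-irrefl refl h }) (overlinedFrom-positions (suc p) cs)
  ... | refl , e₁ with marked-injective b b′ (noBot cs) (noBot cs′) e₁
    where
    noBot : ∀ cs → All (_≢ (p , botRow)) (overlinedFrom (suc p) cs)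
    noBot cs = All.map (λ { h refl → <-irrefl refl h }) (overlinedFrom-positions (suc p) cs)
  ... | refl , e₂ = cong (_ ∷_) (overlinedFrom-injective (suc p) cs cs′ ta′ ba′ e₂)

  Overlining : ℕ → List ℕ → List ℕ → List (ℕ × Row) → Set
  Overlining p A B es = ∃ λ cs → map top cs ≡ A × map bot cs ≡ B × overlinedFrom p cs ≡ es

  unmarked : ∀ p A B {es} a b → Overlining (suc p) A B es → Overlining p (a ∷ A) (b ∷ B) es
  unmarked p A B a b (cs , refl , refl , refl) = col a b false false ∷ cs , refl , refl , refl

  marked : ∀ r p A B {es} a b → Overlining (suc p) A B es → Overlining p (a ∷ A) (b ∷ B) ((p , r) ∷ es)
  marked topRow p A B a b (cs , refl , refl , refl) = col a b true false ∷ cs , refl , refl , refl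
  marked botRow p A B a b (cs , refl , refl , refl) = col a b false true ∷ cs , refl , refl , refl

  overline₀ : ∀ p A B → length A ≡ length B → Overlining p A B []
  overline₀ p []      []      _ = [] , refl , refl , refl
  overline₀ p (a ∷ A) (b ∷ B) e = unmarked p A B a b (overline₀ (suc p) A B (suc-injective e))

  overline₁ : ∀ p A B → length A ≡ length B → ∀ c r → p ≤ c → c < p + length A → Overlining p A B ((c , r) ∷ [])
  overline₁ p [] B e c r h₁ h₂ = ⊥-elim (<⇒≱ h₂ (subst (_≤ c) (sym (+-identityʳ p)) h₁))
  overline₁ p (a ∷ A) (b ∷ B) e c r h₁ h₂ with p ≟ c
  ... | yes refl = marked r p A B a b (overline₀ (suc p) A B (suc-injective e))
  ... | no p≢c   = unmarked p A B a b
    (overline₁ (suc p) A B (suc-injective e) c r (≤∧≢⇒< h₁ p≢c) (subst (c <_) (+-suc p (length A)) h₂))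

  overline₂ : ∀ p A B → length A ≡ length B → ∀ c r c′ r′ → p ≤ c → c < c′ → c′ < p + length A →
    Overlining p A B ((c , r) ∷ (c′ , r′) ∷ [])
  overline₂ p [] B e c r c′ r′ h₁ h₂ h₃ = ⊥-elim (<⇒≱ h₃ (subst (_≤ c′) (sym (+-identityʳ p)) (≤-trans h₁ (<⇒≤ h₂))))
  overline₂ p (a ∷ A) (b ∷ B) e c r c′ r′ h₁ h₂ h₃ with p ≟ c
  ... | yes refl = marked r p A B a b
    (overline₁ (suc p) A B (suc-injective e) c′ r′ h₂ (subst (c′ <_) (+-suc p (length A)) h₃))
  ... | no p≢c   = unmarked p A B a b
    (overline₂ (suc p) A B (suc-injective e) c r c′ r′ (≤∧≢⇒< h₁ p≢c) h₂ (subst (c′ <_) (+-suc p (length A)) h₃))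

  -- Merges cases (b) and (c). With the overlines as an index, uniqueness of the overlining becomes
  -- an equation between lists.
  data Dotted (k i : ℕ) (cs : List Column) (j : ℕ) (s : Sign) : List (ℕ × Row) → Set where
    single : ∀ {c} → At (anchors k i cs) j (c , s) → Dotted k i cs j s ((c , rowOf s) ∷ [])
    double : ∀ {c₁ s₁ c₂} → At (anchors k i cs) j (c₁ , s₁) → At (anchors k i cs) (suc j) (c₂ , s) →
             Dotted k i cs j s ((c₁ , rowOf s₁) ∷ (c₂ , rowOf s) ∷ [])

  singular⇒dotted : ∀ {k i cs m j t s} → SingularCase k i cs m t → m ≡ suc j → t ≡ just s →
    Dotted k i cs j s (overlined cs)
  singular⇒dotted (caseB j c e o) refl refl =
    subst (Dotted _ _ _ _ _) (sym o) (single (subst (At _ _) e (At-lookup _ j)))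
  singular⇒dotted (caseC j c e o) refl refl =
    subst (Dotted _ _ _ _ _) (sym o) (single (subst (At _ _) e (At-lookup _ j)))
  singular⇒dotted {k} {i} {cs} (caseD j j′ h c₁ s₁ c₂ s₂ e₁ e₂ o) refl refl =
    subst (Dotted _ _ _ _ _) (sym o)
      (double (subst (At _ _) e₁ (At-lookup _ j))
              (subst (λ n → At (anchors k i cs) n _) h (subst (At _ _) e₂ (At-lookup _ j′))))

  dotted⇒singular : ∀ {k i cs j s es} → Dotted k i cs j s es → overlined cs ≡ es →
    SingularCase k i cs (suc j) (just s)
  dotted⇒singular {s = positive} (single a) o with lookup-At a
  ... | j , refl , e = caseB j _ e o
  dotted⇒singular {s = negative} (single a) o with lookup-At a
  ... | j , refl , e = caseC j _ e o
  dotted⇒singular (double a b) o with lookup-At a | lookup-At b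
  ... | j , refl , e | j′ , h , e′ = caseD j j′ h _ _ _ _ e e′ o

  -- One overline needs sign `s` at anchor `j`, two need it at anchor `suc j`; adjacent anchors have
  -- opposite signs, so the columns admit only one of the two.
  dotted-unique : ∀ {k i cs j s es es′} → Dotted k i cs j s es → Dotted k i cs j s es′ → es ≡ es′
  dotted-unique (single a) (single b) with At-functional a b
  ... | refl = refl
  dotted-unique (double a b) (double a′ b′) with At-functional a a′ | At-functional b b′
  ... | refl | refl = refl
  dotted-unique {k} {i} {cs} {j} (single a) (double b b′) with At-functional a b
  ... | refl = ⊥-elim (anchors-alternate 0 nothing j (map (kind k i) cs) b b′ refl)
  dotted-unique {k} {i} {cs} {j} (double b b′) (single a) with At-functional a b
  ... | refl = ⊥-elim (anchors-alternate 0 nothing j (map (kind k i) cs) b b′ refl)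

  -- With a common index, matching would have to unify `suc (toℕ j)` with `suc (toℕ j′)`. Free
  -- indices and separate equations leave this to `toℕ-injective`.
  singular-unique : ∀ {k i cs m t m′ t′} (x : SingularCase k i cs m t) (y : SingularCase k i cs m′ t′) →
    m ≡ m′ → t ≡ t′ → _≡_ {A = Σ ℕ λ m → Σ (Maybe Sign) (SingularCase k i cs m)} (m , t , x) (m′ , t′ , y)
  singular-unique (caseA o) (caseA o′) _ _ rewrite ≡-irrelevant o o′ = refl
  singular-unique (caseB j c e o) (caseB j′ c′ e′ o′) h _ with toℕ-injective (suc-injective h)
  ... | refl with trans (sym e) e′
  ...   | refl rewrite ≡-irrelevant e e′ | ≡-irrelevant o o′ = refl
  singular-unique (caseC j c e o) (caseC j′ c′ e′ o′) h _ with toℕ-injective (suc-injective h)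
  ... | refl with trans (sym e) e′
  ...   | refl rewrite ≡-irrelevant e e′ | ≡-irrelevant o o′ = refl
  singular-unique (caseD j l h c₁ s₁ c₂ s₂ e₁ e₂ o) (caseD j′ l′ h′ c₁′ s₁′ c₂′ s₂′ e₁′ e₂′ o′) g _
    with toℕ-injective (suc-injective g)
  ... | refl with toℕ-injective (trans h (sym h′))
  ...   | refl with trans (sym e₁) e₁′ | trans (sym e₂) e₂′
  ...     | refl | refl rewrite ≡-irrelevant h h′ | ≡-irrelevant e₁ e₁′ | ≡-irrelevant e₂ e₂′ | ≡-irrelevant o o′ = refl
  singular-unique (caseB _ _ _ o) (caseD _ _ _ _ _ _ _ _ _ o′) _ _ with trans (sym o) o′
  ... | ()
  singular-unique (caseC _ _ _ o) (caseD _ _ _ _ _ _ _ _ _ o′) _ _ with trans (sym o) o′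
  ... | ()
  singular-unique (caseD _ _ _ _ _ _ _ _ _ o) (caseB _ _ _ o′) _ _ with trans (sym o) o′
  ... | ()
  singular-unique (caseD _ _ _ _ _ _ _ _ _ o) (caseC _ _ _ o′) _ _ with trans (sym o) o′
  ... | ()

  singular-irrelevant : ∀ {k i cs m t} (x y : SingularCase k i cs m t) → x ≡ y
  singular-irrelevant x y with singular-unique x y refl refl
  ... | refl = refl

  -- The bijections

  -- As `P` and `Q` are proof-irrelevant, both round trips reduce to first components, where they
  -- follow from functionality and injectivity. Injectivity may use `P`: for symbols it is the side
  -- condition that fixes the overlines once the rows are known.
  relation-↔ : ∀ {X Y : Set} {P : X → Set} {Q : Y → Set} (R : X → Y → Set) →
    (∀ {x} (a b : P x) → a ≡ b) → (∀ {y} (a b : Q y) → a ≡ b) →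
    (∀ x → P x → ∃ λ y → Q y × R x y) → (∀ y → Q y → ∃ λ x → P x × R x y) →
    (∀ {x y y′} → R x y → R x y′ → y ≡ y′) →
    (∀ {x x′ y} → P x → P x′ → R x y → R x′ y → x ≡ x′) →
    Σ X P ↔ Σ Y Q
  relation-↔ {X} {Y} {P} {Q} R P-irr Q-irr total surjective functional injective = mk↔ₛ′ to from to∘from from∘to
    where
    to : Σ X P → Σ Y Q
    to (x , a) with total x a
    ... | y , b , _ = y , b
    from : Σ Y Q → Σ X P
    from (y , b) with surjective y b
    ... | x , a , _ = x , a
    ext : ∀ {Z : Set} {S : Z → Set} → (∀ {z} (a b : S z) → a ≡ b) → ∀ {z z′} (a : S z) (b : S z′) → z ≡ z′ →
          _≡_ {A = Σ Z S} (z , a) (z′ , b)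
    ext irr a b refl = cong (_ ,_) (irr a b)
    to∘from : ∀ w → to (from w) ≡ w
    to∘from (y , b) with surjective y b
    ... | x , a , r with total x a
    ...   | y′ , b′ , r′ = ext Q-irr b′ b (functional r′ r)
    from∘to : ∀ w → from (to w) ≡ w
    from∘to (x , a) with total x a
    ... | y , b , r with surjective y b
    ...   | x′ , a′ , r′ = ext P-irr a′ a (injective a′ a r′ r)

  ×-irrelevant : ∀ {A B : Set} → (∀ (a b : A) → a ≡ b) → (∀ (a b : B) → a ≡ b) → (x y : A × B) → x ≡ y
  ×-irrelevant f g (a , b) (a′ , b′) = cong₂ _,_ (f a a′) (g b b′)

  -- Between bounded lists and the predicates of the definitions

  linked⇒decreasing : ∀ {A} → Linked _>_ A → ∃ λ u → Decreasing (_< u) A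
  linked⇒decreasing Linked.[]              = 0 , end
  linked⇒decreasing {x ∷ []} Linked.[-]     = suc x , n<1+n x ▸ end
  linked⇒decreasing {x ∷ _} (h Linked.∷ L) = suc x , n<1+n x ▸ go h L
    where
    go : ∀ {x y A} → y < x → Linked _>_ (y ∷ A) → Decreasing (_< x) (y ∷ A)
    go h Linked.[-]        = h ▸ end
    go h (h′ Linked.∷ L) = h ▸ go h′ L

  decreasing⇒linked : ∀ {P A} → Decreasing P A → Linked _>_ A
  decreasing⇒linked end             = Linked.[]
  decreasing⇒linked (_ ▸ end)       = Linked.[-]
  decreasing⇒linked {A = a ∷ _} (_ ▸ (h ▸ As)) = h Linked.∷ decreasing⇒linked {_< a} (h ▸ As)

  partition⇒parts : ∀ {ls} → All (1 ≤_) ls → Linked _≥_ ls → ∃ λ t → PartsBelow t ls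
  partition⇒parts {[]}     _ _ = 0 , none
  partition⇒parts {l ∷ ls} P L = l , go ≤-refl P L
    where
    go : ∀ {t l ls} → l ≤ t → All (1 ≤_) (l ∷ ls) → Linked _≥_ (l ∷ ls) → PartsBelow t (l ∷ ls)
    go {l = suc l} h (_ All.∷ All.[]) _ = part h none
    go {l = suc l} h (_ All.∷ P@(_ All.∷ _)) (h′ Linked.∷ L) = part h (go h′ P L)

  parts⇒partition : ∀ {t ls} → PartsBelow t ls → All (1 ≤_) ls × Linked _≥_ ls
  parts⇒partition none = All.[] , Linked.[]
  parts⇒partition (part _ none) = (s≤s z≤n All.∷ All.[]) , Linked.[-]
  parts⇒partition (part _ P@(part h _)) with parts⇒partition P
  ... | a , l = (s≤s z≤n All.∷ a) , (h Linked.∷ l)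

  -- The size of a symbol counts one unit per column, and `X` has `m` entries fewer than there are
  -- columns: hence the summand `m`. The `m * m` comes from `reflection-sum`.
  ChargedPair : ℕ → ℕ → ℕ → List ℕ × List ℕ → Set
  ChargedPair n m w (X , Y) = Linked _>_ X × Linked _>_ Y × length Y ≡ length X + (m + m)
    × sum X + sum Y + length X + (w + m) ≡ n + m * m

  PartitionWithDeficit : ℕ → ℕ → List ℕ → Set
  PartitionWithDeficit n D ls = All (1 ≤_) ls × Linked _≥_ ls × sum ls + D ≡ n

  chargedPair-irrelevant : ∀ n m w {Z} (a b : ChargedPair n m w Z) → a ≡ b
  chargedPair-irrelevant _ _ _ = ×-irrelevant (Linked.irrelevant <-irrelevant)
    (×-irrelevant (Linked.irrelevant <-irrelevant) (×-irrelevant ≡-irrelevant ≡-irrelevant))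

  deficit-irrelevant : ∀ n D {ls} (a b : PartitionWithDeficit n D ls) → a ≡ b
  deficit-irrelevant _ _ = ×-irrelevant (All.irrelevant ≤-irrelevant)
    (×-irrelevant (Linked.irrelevant ≤-irrelevant) ≡-irrelevant)

  triangle-double : ∀ m → triangle (m + m) + m ≡ m * m + m * m
  triangle-double zero = refl
  triangle-double (suc m) rewrite +-suc m m = step m (triangle (m + m)) (triangle-double m)
    where
    step : ∀ m t → t + m ≡ m * m + m * m → suc (m + m) + (m + m + t) + suc m ≡ suc m * suc m + suc m * suc m
    step m t e = eqn e (solve (m ∷ t ∷ []))

  -- The β-numbers contribute `triangle (m + m)`, which together with `m` is twice `m * m`; one copy
  -- cancels against `ChargedPair`, the other stays in the deficit.
  charged↔partition : ∀ n m w →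
    Σ (List ℕ × List ℕ) (ChargedPair n m w) ↔ Σ (List ℕ) (PartitionWithDeficit n (m * m + w))
  charged↔partition n m w = relation-↔ (λ { (X , Y) ls → Hook (m + m) ls Y X })
    (chargedPair-irrelevant n m w) (deficit-irrelevant n (m * m + w))
    (λ { (X , Y) (LX , LY , len , s) → from X Y LX LY len s })
    (λ { ls (P , L , s) → to ls P L s })
    (λ H H′ → hook-injective refl refl H H′)
    (λ _ _ H H′ → cong₂ _,_ (proj₂ (hook-functional refl H H′)) (proj₁ (hook-functional refl H H′)))
    where
    sums : ∀ {a b t} → a ≡ b + t → t + m ≡ m * m + m * m → a + (w + m) ≡ n + m * m → b + (m * m + w) ≡ n
    sums {b = b} {t} refl e s = eqn (s ⊞ sym e) (solve (b ∷ t ∷ m ∷ w ∷ n ∷ []))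
    sums⁻ : ∀ {a b t} → a ≡ b + t → t + m ≡ m * m + m * m → b + (m * m + w) ≡ n → a + (w + m) ≡ n + m * m
    sums⁻ {b = b} {t} refl e s = eqn (s ⊞ e) (solve (b ∷ t ∷ m ∷ w ∷ n ∷ []))
    from : ∀ X Y → Linked _>_ X → Linked _>_ Y → length Y ≡ length X + (m + m) →
      sum X + sum Y + length X + (w + m) ≡ n + m * m →
      ∃ λ ls → PartitionWithDeficit n (m * m + w) ls × Hook (m + m) ls Y X
    from X Y LX LY len s with linked⇒decreasing LX | linked⇒decreasing LY
    ... | u , Xs | v , Ys
      with fromHooks (m + m) {v} {u} Y X (mapDec (λ h → ≤-trans h (m≤m+n v _)) Ys) Xs len
    ... | ls , H , P , _ with parts⇒partition P
    ... | a , l = ls , (a , l , sums (hook-sum H) (triangle-double m) s) , H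
    to : ∀ ls → All (1 ≤_) ls → Linked _≥_ ls → sum ls + (m * m + w) ≡ n →
      ∃ λ Z → ChargedPair n m w Z × Hook (m + m) ls (proj₂ Z) (proj₁ Z)
    to ls P L s with partition⇒parts P L
    ... | t , Ps with toHooks (m + m) (length ls) {t} {length ls} ls ≤-refl Ps (m≤m+n _ _)
    ... | Y , X , H , Ys , Xs = (X , Y)
      , (decreasing⇒linked Xs , decreasing⇒linked Ys , hook-length H , sums⁻ (hook-sum H) (triangle-double m) s) , H

  ≤-difference : ∀ a b c d → (pos a ℤ.- pos b ℤ.≤ pos c ℤ.- pos d) ⇔ (a + d ≤ c + b)
  ≤-difference a b c d = mk⇔
    (λ h → ℤ.drop‿+≤+ (subst₂ ℤ._≤_ (left (pos a) (pos b) (pos d)) (right (pos b) (pos c) (pos d))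
                        (ℤ.+-monoˡ-≤ (pos b ℤ.+ pos d) h)))
    (λ h → subst₂ ℤ._≤_ (left⁻ (pos a) (pos b) (pos d)) (right⁻ (pos b) (pos c) (pos d))
             (ℤ.+-monoˡ-≤ (ℤ.- (pos b ℤ.+ pos d)) (ℤ.+≤+ h)))
    where
    left : ∀ a b d → (a ℤ.- b) ℤ.+ (b ℤ.+ d) ≡ a ℤ.+ d
    left = ℤ.solve-∀
    right : ∀ b c d → (c ℤ.- d) ℤ.+ (b ℤ.+ d) ≡ c ℤ.+ b
    right = ℤ.solve-∀
    left⁻ : ∀ a b d → (a ℤ.+ d) ℤ.+ (ℤ.- (b ℤ.+ d)) ≡ a ℤ.- b
    left⁻ = ℤ.solve-∀
    right⁻ : ∀ b c d → (c ℤ.+ b) ℤ.+ (ℤ.- (b ℤ.+ d)) ≡ c ℤ.- d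
    right⁻ = ℤ.solve-∀

  deficit↔partitionZ : ∀ n D {z} → z ≡ pos n ℤ.- pos D → Σ (List ℕ) (PartitionWithDeficit n D) ↔ PartitionZ z
  deficit↔partitionZ n D {z} e with z | e
  ... | pos N | e = relation-↔ _≡_ (deficit-irrelevant n D)
        (×-irrelevant (All.irrelevant ≤-irrelevant) (×-irrelevant (Linked.irrelevant ≤-irrelevant) ≡-irrelevant))
        (λ { ls (P , L , s) → ls , (P , L , +-cancelʳ-≡ D _ _ (trans s (sym total))) , refl })
        (λ { ls (P , L , s) → ls , (P , L , trans (cong (_+ D) s) total) , refl })
        (λ { refl refl → refl }) (λ { _ _ refl refl → refl })
    where
    cancel : ∀ n D → n ℤ.- D ℤ.+ D ≡ n
    cancel = ℤ.solve-∀
    total : N + D ≡ n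
    total = ℤ.+-injective (trans (cong (ℤ._+ pos D) e) (cancel (pos n) (pos D)))
  ... | -[1+ N ] | e = mk↔ₛ′ (⊥-elim ∘ empty) ⊥-elim (λ ()) (λ w → ⊥-elim (empty w))
    where
    cancel : ∀ x D → x ℤ.+ D ℤ.- D ≡ x
    cancel = ℤ.solve-∀
    empty : Σ (List ℕ) (PartitionWithDeficit n D) → ⊥
    empty (ls , _ , _ , s) with trans e (trans (cong (λ n → pos n ℤ.- pos D) (sym s)) (cancel (pos (sum ls)) (pos D)))
    ... | ()

  -- The deficit in closed form

  lastOf : ℕ → ℕ → ℕ → ℕ
  lastOf zero    p q = p
  lastOf (suc j) p q = lastOf j q p

  -- Put `q` in front of the sequence `p, q, p, ...` and add neighbours: each of the `suc j` pairs
  -- gives `p + q`, every inner term is used twice, and the last term is left over once.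
  altSum-double : ∀ j p q → altSum (suc j) p q + altSum (suc j) p q + q ≡ (p + q) * suc j + lastOf j p q
  altSum-double zero p q = start p q
    where
    start : ∀ p q → (p + 0) + (p + 0) + q ≡ (p + q) * 1 + p
    start p q = solve (p ∷ q ∷ [])
  altSum-double (suc j) p q = step (altSum (suc j) q p) (lastOf j q p) (altSum-double j q p)
    where
    step : ∀ t l → t + t + p ≡ (q + p) * suc j + l → (p + t) + (p + t) + q ≡ (p + q) * suc (suc j) + l
    step t l e = eqn e (solve (t ∷ l ∷ p ∷ q ∷ j ∷ []))

  sucC2 : ∀ m → suc m C 2 ≡ m + m C 2
  sucC2 m = trans (sym (nCk+nC[k+1]≡[n+1]C[k+1] m 1)) (cong (_+ m C 2) (nC1≡n m))

  -- A hit with `m` hits after it contributes `2m + 1 + p + 2 altSum m q p`, which is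
  -- `(p + q + 2) m` plus the last threshold plus 1. Summation over `m` produces the binomial
  -- coefficient.
  weight-formula : ∀ j p q →
    suc j * suc j + weight (suc j) p q ≡ suc (suc (p + q)) * (suc j C 2) + suc (lastOf j p q) * suc j
  weight-formula zero p q = start p q
    where
    start : ∀ p q → 1 + (p + 0) ≡ suc (suc (p + q)) * 0 + suc p * 1
    start p q = solve (p ∷ q ∷ [])
  weight-formula (suc j) p q rewrite sucC2 (suc j) =
    step (suc j) (altSum (suc j) q p) (weight (suc j) q p) (suc j C 2) (lastOf j q p)
      (altSum-double j q p) (weight-formula j q p)
    where
    step : ∀ m t w c l → t + t + p ≡ (q + p) * m + l → m * m + w ≡ suc (suc (q + p)) * c + suc l * m →
      suc m * suc m + (p + (t + t + w)) ≡ suc (suc (p + q)) * (m + c) + suc l * suc m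
    step m t w c l e₁ e₂ = eqn (e₁ ⊞ e₂) (solve (m ∷ t ∷ w ∷ c ∷ l ∷ p ∷ q ∷ []))

  alternate-opposite : ∀ s j → alternate (opposite s) j ≡ opposite (alternate s j)
  alternate-opposite s zero    = refl
  alternate-opposite s (suc j) = alternate-opposite (opposite s) j

  opposite-involutive : ∀ s → opposite (opposite s) ≡ s
  opposite-involutive positive = refl
  opposite-involutive negative = refl

  alternate-involutive : ∀ s j → alternate (alternate s j) j ≡ s
  alternate-involutive s zero    = refl
  alternate-involutive s (suc j)
    rewrite alternate-opposite s j | opposite-involutive (alternate s j) = alternate-involutive s j

  -- Symbols for fixed `k` and `i`

  module _ (p q : ℕ) (p+q≥1 : 1 ≤ p + q) where

    private
      i = suc p
      k = suc (q + suc p)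

    threshold : Sign → ℕ
    threshold negative = p
    threshold positive = q

    entry : Sign → Column → ℕ
    entry negative = top
    entry positive = bot

    Exceeds : Sign → Column → Set
    Exceeds s c = entry s c + threshold s ≤ entry (opposite s) c

    private
      positive⇔ : ∀ c → (pos k ℤ.- pos i ℤ.- pos 1 ℤ.≤ pos (top c) ℤ.- pos (bot c)) ⇔ Exceeds positive c
      positive⇔ (col a b _ _) = mk⇔
        (λ h → lower (Equivalence.to (≤-difference k (suc i) a b) (subst (ℤ._≤ _) (assoc (pos k) (pos i)) h)))
        (λ h → subst (ℤ._≤ _) (sym (assoc (pos k) (pos i))) (Equivalence.from (≤-difference k (suc i) a b) (raise h)))
        where
        assoc : ∀ x y → x ℤ.- y ℤ.- pos 1 ≡ x ℤ.- (pos 1 ℤ.+ y)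
        assoc = ℤ.solve-∀
        lower : suc (q + suc p) + b ≤ a + suc (suc p) → b + q ≤ a
        lower h = lin 0 h (solve (a ∷ b ∷ p ∷ q ∷ []))
        raise : b + q ≤ a → suc (q + suc p) + b ≤ a + suc (suc p)
        raise h = lin 0 h (solve (a ∷ b ∷ p ∷ q ∷ []))

      negative⇔ : ∀ c → (pos (top c) ℤ.- pos (bot c) ℤ.≤ pos 1 ℤ.- pos i) ⇔ Exceeds negative c
      negative⇔ (col a b _ _) = mk⇔
        (λ h → lower (Equivalence.to (≤-difference a b 1 i) h))
        (λ h → Equivalence.from (≤-difference a b 1 i) (raise h))
        where
        lower : a + suc p ≤ 1 + b → a + p ≤ b
        lower h = lin 0 h (solve (a ∷ b ∷ p ∷ []))
        raise : a + p ≤ b → a + suc p ≤ 1 + b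
        raise h = lin 0 h (solve (a ∷ b ∷ p ∷ []))

      exclusive : ∀ c → Exceeds positive c → Exceeds negative c → ⊥
      exclusive (col a b _ _) = absurd
        where
        absurd : b + q ≤ a → a + p ≤ b → ⊥
        absurd h₁ h₂ = <-irrefl refl
          (lin {u = 1} {v = 0} 0 (h₁ ⊕ h₂ ⊕ p+q≥1) (solve (a ∷ b ∷ p ∷ q ∷ [])))

    kind⇒exceeds : ∀ s c → kind k i c ≡ just s → Exceeds s c
    kind⇒exceeds s c e with (pos k ℤ.- pos i ℤ.- pos 1) ℤ.≤? (pos (top c) ℤ.- pos (bot c))
    kind⇒exceeds positive c e | yes h = Equivalence.to (positive⇔ c) h
    kind⇒exceeds s c e | no _ with (pos (top c) ℤ.- pos (bot c)) ℤ.≤? (pos 1 ℤ.- pos i)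
    kind⇒exceeds negative c e | no _ | yes h = Equivalence.to (negative⇔ c) h

    exceeds⇒kind : ∀ s c → Exceeds s c → kind k i c ≡ just s
    exceeds⇒kind s c x with (pos k ℤ.- pos i ℤ.- pos 1) ℤ.≤? (pos (top c) ℤ.- pos (bot c))
    exceeds⇒kind positive c x | yes h = refl
    exceeds⇒kind negative c x | yes h = ⊥-elim (exclusive c (Equivalence.to (positive⇔ c) h) x)
    exceeds⇒kind positive c x | no n = ⊥-elim (n (Equivalence.from (positive⇔ c) x))
    exceeds⇒kind negative c x | no _ with (pos (top c) ℤ.- pos (bot c)) ℤ.≤? (pos 1 ℤ.- pos i)
    ... | yes _ = refl
    ... | no n  = ⊥-elim (n (Equivalence.from (negative⇔ c) x))

    row : Sign → List Column → List ℕ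
    row s = map (entry s)

    OscillatesFrom : Sign → ℕ → List Column → Set
    OscillatesFrom s m cs =
      Oscillates m (threshold s) (threshold (opposite s)) (row s cs) (row (opposite s) cs)

    kinds : List Column → List (Maybe Sign)
    kinds = map (kind k i)

    alternates⇒oscillates : ∀ s m cs → Alternates s m (kinds cs) → OscillatesFrom s m cs
    alternates⇒oscillates s zero cs _ = done
    alternates⇒oscillates s (suc m) (c ∷ cs) a = go (kind k i c) refl a
      where
      go : ∀ κ → kind k i c ≡ κ → Alternates s (suc m) (κ ∷ kinds cs) → OscillatesFrom s (suc m) (c ∷ cs)
      go _ e (here a) = here (kind⇒exceeds s c e)
        (subst (λ t → Oscillates m (threshold (opposite s)) (threshold t) (row (opposite s) cs) (row t cs))
          (opposite-involutive s) (alternates⇒oscillates (opposite s) m cs a))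
      go _ e (skip n a) = skip (≰⇒> (λ x → n (trans (sym e) (exceeds⇒kind s c x))))
        (alternates⇒oscillates s (suc m) cs a)

    oscillates⇒alternates : ∀ s m cs → OscillatesFrom s m cs → Alternates s m (kinds cs)
    oscillates⇒alternates s zero    cs       _ = done
    oscillates⇒alternates s (suc m) (c ∷ cs) (here x o) rewrite exceeds⇒kind s c x =
      here (oscillates⇒alternates (opposite s) m cs
        (subst (λ t → Oscillates m (threshold (opposite s)) (threshold t) (row (opposite s) cs) (row t cs))
          (sym (opposite-involutive s)) o))
    oscillates⇒alternates s (suc m) (c ∷ cs) (skip h o) =
      skip (λ e → <⇒≱ h (kind⇒exceeds s c e)) (oscillates⇒alternates s (suc m) cs o)

    kinds-cong : ∀ cs cs′ → map top cs ≡ map top cs′ → map bot cs ≡ map bot cs′ → kinds cs ≡ kinds cs′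
    kinds-cong []       []         _  _  = refl
    kinds-cong (c ∷ cs) (c′ ∷ cs′) et eb with ∷-injective et | ∷-injective eb
    ... | e₁ , et′ | e₂ , eb′ = cong₂ _∷_ (kind-cong c c′ e₁ e₂) (kinds-cong cs cs′ et′ eb′)
      where
      kind-cong : ∀ c c′ → top c ≡ top c′ → bot c ≡ bot c′ → kind k i c ≡ kind k i c′
      kind-cong (col a b _ _) (col a b _ _) refl refl
        with (pos k ℤ.- pos i ℤ.- pos 1) ℤ.≤? (pos a ℤ.- pos b)
      ... | yes _ = refl
      ... | no _ with (pos a ℤ.- pos b) ℤ.≤? (pos 1 ℤ.- pos i)
      ...   | yes _ = refl
      ...   | no _  = refl

    singular⇒alternates : ∀ s j cs → SingularCase k i cs (suc j) (just (alternate s j)) → Alternates s (suc j) (kinds cs)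
    singular⇒alternates s j cs S with singular⇒dotted S refl refl
    ... | D = go D
      where
      go : ∀ {es} → Dotted k i cs j (alternate s j) es → Alternates s (suc j) (kinds cs)
      go (single a)   = dotted⇒alternates 0 s j (kinds cs) (inj₁ a)
      go (double _ a) = dotted⇒alternates 0 s j (kinds cs) (inj₂ a)

    singular-injective : ∀ {m s} cs cs′ → SingularCase k i cs (suc m) (just s) → SingularCase k i cs′ (suc m) (just s) →
      map top cs ≡ map top cs′ → map bot cs ≡ map bot cs′ → cs ≡ cs′
    singular-injective {m} {s} cs cs′ S S′ et eb = overlinedFrom-injective 0 cs cs′ et eb
      (dotted-unique {k} {i} {cs} (singular⇒dotted S refl refl)
        (transport (sym (kinds-cong cs cs′ et eb)) (singular⇒dotted S′ refl refl)))
      where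
      transport : ∀ {es} → kinds cs′ ≡ kinds cs → Dotted k i cs′ m s es → Dotted k i cs m s es
      transport e (single a)   = single (subst (λ ks → At (anchorsFrom 0 nothing ks) m _) e a)
      transport e (double a b) = double (subst (λ ks → At (anchorsFrom 0 nothing ks) m _) e a)
                                        (subst (λ ks → At (anchorsFrom 0 nothing ks) (suc m) _) e b)

    -- Existing flags are discarded: kinds depend only on the entries, so the required overlines can
    -- be put on the bare rows without moving the anchors.
    alternates⇒singular : ∀ s j cs → Alternates s (suc j) (kinds cs) →
      ∃ λ cs′ → map top cs′ ≡ map top cs × map bot cs′ ≡ map bot cs ×
        SingularCase k i cs′ (suc j) (just (alternate s j))
    alternates⇒singular s j cs a = choose (alternates⇒dotted 0 s j (kinds cs) a)
      where
      len : length (map top cs) ≡ length (map bot cs)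
      len = trans (length-map top cs) (sym (length-map bot cs))
      widths : length (kinds cs) ≡ length (map top cs)
      widths = trans (length-map _ cs) (sym (length-map top cs))
      Anchor : List Column → ℕ → ℕ × Sign → Set
      Anchor cs = At (anchors k i cs)
      transport : ∀ cs′ {j x} → map top cs′ ≡ map top cs → map bot cs′ ≡ map bot cs → Anchor cs j x → Anchor cs′ j x
      transport cs′ {j} {x} et eb = subst (λ ks → At (anchorsFrom 0 nothing ks) j x) (sym (kinds-cong cs′ cs et eb))
      choose : (∃ λ c → Anchor cs j (c , alternate s j)) ⊎ (∃ λ c → Anchor cs (suc j) (c , alternate s j)) →
        ∃ λ cs′ → map top cs′ ≡ map top cs × map bot cs′ ≡ map bot cs ×
          SingularCase k i cs′ (suc j) (just (alternate s j))
      choose (inj₁ (c , b)) with anchor-position 0 nothing j (kinds cs) b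
      ... | _ , h with overline₁ 0 (map top cs) (map bot cs) len c (rowOf (alternate s j)) z≤n
                        (subst (c <_) widths h)
      ... | cs′ , et , eb , o = cs′ , et , eb , dotted⇒singular (single (transport cs′ et eb b)) o
      choose (inj₂ (c′ , b′)) with At-pred b′
      ... | (c , t) , b
        with overline₂ 0 (map top cs) (map bot cs) len c (rowOf t) c′ (rowOf (alternate s j)) z≤n
               (anchors-increase 0 nothing j (kinds cs) b b′)
               (subst (c′ <_) widths (proj₂ (anchor-position 0 nothing (suc j) (kinds cs) b′)))
      ... | cs′ , et , eb , o =
        cs′ , et , eb , dotted⇒singular (double (transport cs′ et eb b) (transport cs′ et eb b′)) o

    row-cong : ∀ s {cs cs′} → map top cs ≡ map top cs′ → map bot cs ≡ map bot cs′ → row s cs ≡ row s cs′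
    row-cong negative et eb = et
    row-cong positive et eb = eb

    rows-injective : ∀ s {cs cs′} → row s cs ≡ row s cs′ → row (opposite s) cs ≡ row (opposite s) cs′ →
      map top cs ≡ map top cs′ × map bot cs ≡ map bot cs′
    rows-injective negative e e′ = e , e′
    rows-injective positive e e′ = e′ , e

    columns : ∀ s A B → length A ≡ length B → ∃ λ cs → row s cs ≡ A × row (opposite s) cs ≡ B
    columns negative A B e with overline₀ 0 A B e
    ... | cs , e₁ , e₂ , _ = cs , e₁ , e₂
    columns positive A B e with overline₀ 0 B A (sym e)
    ... | cs , e₁ , e₂ , _ = cs , e₂ , e₁

    frobenius-sum : ∀ s cs → sum (map (λ c → top c + bot c + 1) cs) ≡ sum (row s cs) + sum (row (opposite s) cs) + length (row s cs)
    frobenius-sum s [] with s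
    ... | positive = refl
    ... | negative = refl
    frobenius-sum s (c@(col a b _ _) ∷ cs) with s | frobenius-sum s cs
    ... | negative | e = step a b _ _ _ _ e
      where
      step : ∀ a b t x y l → t ≡ x + y + l → a + b + 1 + t ≡ (a + x) + (b + y) + suc l
      step a b t x y l e = eqn e (solve (a ∷ b ∷ t ∷ x ∷ y ∷ l ∷ []))
    ... | positive | e = step a b _ _ _ _ e
      where
      step : ∀ a b t x y l → t ≡ x + y + l → a + b + 1 + t ≡ (b + x) + (a + y) + suc l
      step a b t x y l e = eqn e (solve (a ∷ b ∷ t ∷ x ∷ y ∷ l ∷ []))

    frobenius-rows : ∀ s n cs → IsFrobenius n cs ⇔
      (Linked _>_ (row s cs) × Linked _>_ (row (opposite s) cs) ×
       sum (row s cs) + sum (row (opposite s) cs) + length (row s cs) ≡ n)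
    frobenius-rows negative n cs = mk⇔
      (λ { (t , b , e) → t , b , trans (sym (frobenius-sum negative cs)) e })
      (λ { (t , b , e) → t , b , trans (frobenius-sum negative cs) e })
    frobenius-rows positive n cs = mk⇔
      (λ { (t , b , e) → b , t , trans (sym (frobenius-sum positive cs)) e })
      (λ { (b , t , e) → t , b , trans (frobenius-sum positive cs) e })

    thresholds≥1 : ∀ s → 1 ≤ threshold s + threshold (opposite s)
    thresholds≥1 negative = p+q≥1
    thresholds≥1 positive = subst (1 ≤_) (+-comm p q) p+q≥1

    Reflected : Sign → ℕ → List Column → List ℕ × List ℕ → Set
    Reflected s m cs (X , Y) = ∃₂ λ u v →
      Reflection m (threshold s) (threshold (opposite s)) u v (row s cs) (row (opposite s) cs) X Y

    singular↔charged : ∀ s j n →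
      SingOverpartition k i n (suc j) (alternate s j) ↔
      Σ (List ℕ × List ℕ) (ChargedPair n (suc j) (weight (suc j) (threshold s) (threshold (opposite s))))
    singular↔charged s j n = relation-↔ (Reflected s (suc j))
      (×-irrelevant (×-irrelevant (Linked.irrelevant <-irrelevant) (×-irrelevant (Linked.irrelevant <-irrelevant) ≡-irrelevant))
        singular-irrelevant)
      (chargedPair-irrelevant n (suc j) (weight (suc j) (threshold s) (threshold (opposite s))))
      to from
      (λ { (_ , _ , R) (_ , _ , R′) → let e₁ , e₂ = reflection-functional R R′ in cong₂ _,_ e₁ e₂ })
      (λ { (_ , S) (_ , S′) (_ , _ , R) (_ , _ , R′) →
           let e₁ , e₂ = reflection-injective (thresholds≥1 s) R R′
               et , eb = rows-injective s e₁ e₂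
           in singular-injective _ _ S S′ et eb })
      where
      m = suc j
      p₁ = threshold s
      q₁ = threshold (opposite s)
      T = altSum m p₁ q₁
      W = weight m p₁ q₁

      equal-rows : ∀ cs → length (row s cs) ≡ length (row (opposite s) cs)
      equal-rows cs = trans (length-map (entry s) cs) (sym (length-map (entry (opposite s)) cs))

      charge-sum : ∀ {x a} lx la w m → x + w ≡ a + m * m → lx + m ≡ la → a + la ≡ n → x + lx + (w + m) ≡ n + m * m
      charge-sum {x} {a} lx la w m e₁ e₂ e₃ = eqn (e₁ ⊞ e₂ ⊞ e₃) (solve (x ∷ a ∷ lx ∷ la ∷ w ∷ m ∷ n ∷ []))

      uncharge-sum : ∀ {x a} lx la w m → x + w ≡ a + m * m → lx + m ≡ la → x + lx + (w + m) ≡ n + m * m → a + la ≡ n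
      uncharge-sum {x} {a} lx la w m e₁ e₂ e₃ =
        eqn (sym e₁ ⊞ sym e₂ ⊞ e₃) (solve (x ∷ a ∷ lx ∷ la ∷ w ∷ m ∷ n ∷ []))

      to : ∀ cs → IsFrobenius n cs × SingularCase k i cs m (just (alternate s j)) →
        ∃ λ Z → ChargedPair n m W Z × Reflected s m cs Z
      to cs (F , S) with Equivalence.to (frobenius-rows s n cs) F
      ... | LA , LB , e with linked⇒decreasing LA | linked⇒decreasing LB
      ... | u , As | v , Bs
        -- The bounds act as a column to the left of the symbol; the first is enlarged so that this
        -- column is not a hit.
        with reflect {u = suc (u + v)} {v} (alternates⇒oscillates s m cs (singular⇒alternates s j cs S))
               (mapDec (λ h → ≤-trans h (≤-trans (m≤m+n u v) (n≤1+n _))) As) Bs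
      ... | X , Y , R with reflection-decreasing (thresholds≥1 s) (≤-trans (s≤s (m≤n+m v u)) (m≤m+n _ p₁)) R
      ... | Xs , Ys = (X , Y)
        , (decreasing⇒linked Xs , decreasing⇒linked Ys , reflection-charge R (equal-rows cs)
          , charge-sum {sum X + sum Y} (length X) (length (row s cs)) W m (reflection-sum R) (reflection-length R (equal-rows cs)) e)
        , _ , _ , R

      from : ∀ Z → ChargedPair n m W Z →
        ∃ λ cs → (IsFrobenius n cs × SingularCase k i cs m (just (alternate s j))) × Reflected s m cs Z
      from (X , Y) (LX , LY , len , e) with linked⇒decreasing LX | linked⇒decreasing LY
      ... | u , Xs | v , Ys
        with unreflect m p₁ q₁ {suc (u + m + (v + T))} {v + T} X Y (thresholds≥1 s)
               (≤-trans (s≤s (m≤n+m (v + T) (u + m))) (m≤m+n _ p₁))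
               (mapDec (λ {x} h → bound₁ {x} T h) Xs) (mapDec (λ h → ≤-trans (+-monoˡ-< T h) (m≤m+n _ m)) Ys) len
        where
        bound₁ : ∀ {x} T → x < u → x + m < suc (u + m + (v + T)) + T
        bound₁ {x} T h = lin (suc (v + T + T)) h (solve (x ∷ u ∷ j ∷ v ∷ T ∷ []))
      ... | A , B , R with columns s A B (reflection-charge⁻ R len)
      ... | cs₀ , refl , refl
        with alternates⇒singular s j cs₀ (oscillates⇒alternates s m cs₀ (reflection⇒oscillates R))
      ... | cs , et , eb , S = cs
        , (Equivalence.from (frobenius-rows s n cs)
            (subst₂ (λ A B → Linked _>_ A × Linked _>_ B × sum A + sum B + length A ≡ n) (sym e₁) (sym e₂)
              ( decreasing⇒linked (proj₁ (reflection-decreasing⁻ R))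
              , decreasing⇒linked (proj₂ (reflection-decreasing⁻ R))
              , uncharge-sum {sum X + sum Y} (length X) (length (row s cs₀)) W m (reflection-sum R)
                  (reflection-length R (equal-rows cs₀)) e)) , S)
        , _ , _ , subst₂ (λ A B → Reflection m p₁ q₁ _ _ A B X Y) (sym e₁) (sym e₂) R
        where
        e₁ = row-cong s et eb
        e₂ = row-cong (opposite s) et eb

    lastOf-threshold : ∀ j s → lastOf j (threshold s) (threshold (opposite s)) ≡ threshold (alternate s j)
    lastOf-threshold zero    s = refl
    lastOf-threshold (suc j) s =
      trans (cong (λ t → lastOf j (threshold (opposite s)) (threshold t)) (sym (opposite-involutive s)))
        (lastOf-threshold j (opposite s))

    thresholds-sum : ∀ s → suc (suc (threshold s + threshold (opposite s))) ≡ k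
    thresholds-sum negative = total
      where
      total : suc (suc (p + q)) ≡ suc (q + suc p)
      total = solve (p ∷ q ∷ [])
    thresholds-sum positive = cong suc (sym (+-suc q p))

    singular↔partition : ∀ s j n {z} →
      z ≡ pos n ℤ.- pos (k * (suc j C 2) + suc (threshold s) * suc j) →
      SingOverpartition k i n (suc j) s ↔ PartitionZ z
    singular↔partition s j n {z} e =
      deficit↔partitionZ n D (trans e (cong (λ x → pos n ℤ.- pos x) (sym D-formula)))
      ↔-∘ (charged↔partition n (suc j) w
      ↔-∘ subst (λ t → SingOverpartition k i n (suc j) t ↔ Σ (List ℕ × List ℕ) (ChargedPair n (suc j) w)) (alternate-involutive s j) (singular↔charged s₁ j n))
      where
      -- The greedy search needs the first sign, while the theorem prescribes the last; alternating
      -- `j` times leads from either to the other.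
      s₁ = alternate s j
      w = weight (suc j) (threshold s₁) (threshold (opposite s₁))
      D = suc j * suc j + w
      D-formula : D ≡ k * (suc j C 2) + suc (threshold s) * suc j
      D-formula = trans (weight-formula j (threshold s₁) (threshold (opposite s₁)))
        (cong₂ (λ κ t → κ * (suc j C 2) + suc t * suc j) (thresholds-sum s₁)
          (trans (lastOf-threshold j s₁) (cong threshold (alternate-involutive s j))))

  singular↔partitionZ : (k i m n : ℕ) → 3 ≤ k → 1 ≤ i → i ≤ k ∸ 1 → 1 ≤ m →
      (SingOverpartition k i n m negative ↔
      PartitionZ (pos n ℤ.- pos (k * (m C 2)) ℤ.- pos (i * m)))
      × (SingOverpartition k i n m positive ↔
      PartitionZ (pos n ℤ.- pos (k * (suc m C 2)) ℤ.+ pos (i * m)))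
  singular↔partitionZ (suc k′) (suc p) (suc j) n (s≤s 2≤k′) _ i≤k′ _ with subtract i≤k′
  ... | q , refl = singular↔partition p q p+q≥1 negative j n (collect (pos n) (pos (k * (m C 2))) (pos (i * m)))
                 , singular↔partition p q p+q≥1 positive j n
                     (trans (cong (λ x → pos n ℤ.- pos x ℤ.+ pos (i * m)) split)
                       (absorb (pos n) (pos (k * (m C 2) + suc q * m)) (pos (i * m))))
    where
    k = suc (q + suc p)
    i = suc p
    m = suc j
    p+q≥1 : 1 ≤ p + q
    p+q≥1 = lin 0 2≤k′ (solve (p ∷ q ∷ []))
    collect : ∀ x a b → x ℤ.- a ℤ.- b ≡ x ℤ.- (a ℤ.+ b)
    collect = ℤ.solve-∀
    absorb : ∀ x a b → x ℤ.- (a ℤ.+ b) ℤ.+ b ≡ x ℤ.- a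
    absorb = ℤ.solve-∀
    -- `suc q` is `k - i`: the deficit for a positive last block arises with the term `(k - i) m`,
    -- and this rewrites it with the larger binomial coefficient and `i m` of opposite sign.
    split : k * (suc m C 2) ≡ k * (m C 2) + suc q * m + i * m
    split rewrite sucC2 m = expand m (m C 2)
      where
      expand : ∀ m c → suc (q + suc p) * (m + c) ≡ suc (q + suc p) * c + suc q * m + suc p * m
      expand m c = solve (m ∷ c ∷ p ∷ q ∷ [])

open import Defs
open import Data.Nat using (ℕ; suc; _*_; _≤_; _∸_)
open import Data.Nat.Combinatorics using (_C_)
open import Data.Integer using (+_; _-_; _+_)
open import Data.Product using (_×_)
open import Function.Bundles using (_↔_)

theorem3p1 : (k i m n : ℕ) → 3 ≤ k → 1 ≤ i → i ≤ k ∸ 1 → 1 ≤ m →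
    (SingOverpartition k i n m negative ↔
    PartitionZ (+ n - + (k * (m C 2)) - + (i * m)))
    × (SingOverpartition k i n m positive ↔
    PartitionZ (+ n - + (k * (suc m C 2)) + + (i * m)))
theorem3p1 = SingularOverpartitions.singular↔partitionZ
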